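{- Let $S$ be an extension of $\mathrm{HA}^\omega$ with a base interpretation of $\mathcal L_S^{\mathcal I}$ that uses the bounding interpretation at the ground type $\mathbb N$. Suppose that the $B$-restricted quantifiers, for a formula $B(x^\sigma,\boldsymbol y)$, are semi-uniform and that $C(x,n^{\mathbb N})$ is an arbitrary formula of the source language. Then the principle $$\forall x\lhd_\sigma B(\boldsymbol y)\,\exists n^{\mathbb N}\,C(x,n)\ \to\ \exists k^{\mathbb N}\,\forall x\lhd_\sigma B(\boldsymbol y)\,\exists n\le k\,C(x,n)$$ is $\mathcal I$-interpretable.
   Context: Source. $\mathrm{HA}^\omega$ is Heyting arithmetic in all finite types generated by $\sigma\to\tau$ from ground types including $\mathbb N$ and $\mathbb B$, with combinators, $0$, successor, recursors, Boolean constants and conditionals, logical equalities $\equiv_\sigma$ at all types, and the usual axioms; $S$ is an extension of it (possibly with further types, constants, relation symbols and axioms) in the language $\mathcal L_S$. Formulas use $\bot,\wedge,\to,\forall x^\sigma,\exists x^\sigma$ and restricted quantifiers (below). $n\le k$ abbreviates a quantifier-free equation of type $\mathbb N$. Target. The target theory $T$ has types and terms including those of $\mathcal L_S$, and witnessing types, including $\mathbb N$, closed under $\rho\to\tau$ and $\rho^*$ (non-empty finite subsets), with combinators, recursors, singleton, union, indexed union, membership and the maximum functional $\mathrm m:\mathbb N^*\to\mathbb N$; it proves the usual elementary facts about these, natural numbers and equality (e.g. $T$ may be the set of truths in the full set-theoretic structure). Boldface letters are (possibly empty) tuples; $\forall\boldsymbol b\in\boldsymbol B$ is componentwise. $\mathcal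 L_S^{\mathcal I}$ adds a unary predicate $\mathcal I_\sigma(x^\sigma)$ for each type. A base interpretation assigns to each relation symbol $R$ tuples of witnessing types $\boldsymbol\tau_R^+,\boldsymbol\tau_R^-$ and a relation $\langle R(\boldsymbol x)\rangle^{\boldsymbol c}_{\boldsymbol d}$ of the target language ($\boldsymbol c:\boldsymbol\tau_R^+$, $\boldsymbol d:\boldsymbol\tau_R^-$); $\langle x\equiv_\sigma y\rangle$ is $x=y$ without witnesses. It uses the bounding interpretation at $\mathbb N$: $\langle\mathcal I_{\mathbb N}(x)\rangle^m$ is $x\le m$ ($m:\mathbb N$, no negative witnesses). $\mathcal U$-interpretation: $\langle\bot\rangle:\equiv\bot$; $\langle A\wedge B\rangle^{\boldsymbol a,\boldsymbol c}_{\boldsymbol b,\boldsymbol d}:\equiv\langle A\rangle^{\boldsymbol a}_{\boldsymbol b}\wedge\langle B\rangle^{\boldsymbol c}_{\boldsymbol d}$; $\langle A\to B\rangle^{\boldsymbol f,\boldsymbol g}_{\boldsymbol a,\boldsymbol d}:\equiv\forall\boldsymbol b\in\boldsymbol g\boldsymbol a\boldsymbol d\,\langle A\rangle^{\boldsymbol a}_{\boldsymbol b}\to\langle B\rangle^{\boldsymbol f\boldsymbol a}_{\boldsymbol d}$; $\langle\forall xA\rangle^{\boldsymbol a}_{\boldsymbol b}:\equiv\forall x\langle A\rangle^{\boldsymbol a}_{\boldsymbol b}$; $\langle\exists xA\rangle^{\boldsymbol a}_{\boldsymbol B}:\equiv\exists x\forall\boldsymbol b\in\boldsymbol B\langle A\rangle^{\boldsymbol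 a}_{\boldsymbol b}$. $A(\boldsymbol x)$ is $\mathcal U$-interpretable if there are closed witnessing terms $\boldsymbol t$ with $T\vdash\forall\boldsymbol b\langle A(\boldsymbol x)\rangle^{\boldsymbol t}_{\boldsymbol b}$. Restricted quantifiers. For a formula $B(x^\sigma,\boldsymbol y)$ there are primitive quantifiers $\forall x\lhd_\sigma B(\boldsymbol y)\,A(x)$, $\exists x\lhd_\sigma B(\boldsymbol y)\,A(x)$ with axioms stating their equivalence with $\forall x^\sigma(B(x,\boldsymbol y)\to A(x))$, $\exists x^\sigma(B(x,\boldsymbol y)\wedge A(x))$. The bounded quantifier $\exists n\le k$ is the restricted quantifier for the formula $n\le k$. Relativization $A^{\mathcal I}$ commutes with connectives, $(\forall x^\sigma A)^{\mathcal I}:\equiv\forall x^\sigma(\mathcal I_\sigma(x)\to A^{\mathcal I})$, $(\exists x^\sigma A)^{\mathcal I}:\equiv\exists x^\sigma(\mathcal I_\sigma(x)\wedge A^{\mathcal I})$, $(\forall x\lhd_\sigma B(\boldsymbol y)A)^{\mathcal I}:\equiv\forall x^\sigma(B(x,\boldsymbol y)^{\mathcal I}\to A^{\mathcal I})$, $(\exists x\lhd_\sigma B(\boldsymbol y)A)^{\mathcal I}:\equiv\exists x^\sigma(B(x,\boldsymbol y)^{\mathcal I}\wedge A^{\mathcal I})$. Put $|A|^{\boldsymbol a}_{\boldsymbol b}:\equiv\langle A^{\mathcal I}\rangle^{\boldsymbol a}_{\boldsymbol b}$; $\boldsymbol a$ are the positive and $\boldsymbol b$ the negative $\mathcal I$-witnesses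 of $A$. A formula $A(\boldsymbol x)$ is $\mathcal I$-interpretable if $\forall\boldsymbol x(\mathcal I(\boldsymbol x)\to A(\boldsymbol x)^{\mathcal I})$ is $\mathcal U$-interpretable. $B(x^\sigma,\boldsymbol y^{\boldsymbol\tau})$ subsumes $\mathcal I_\sigma(x)$ if $\forall\boldsymbol y(\mathcal I_{\boldsymbol\tau}(\boldsymbol y)\to\forall x^\sigma(B(x,\boldsymbol y)^{\mathcal I}\to\mathcal I_\sigma(x)))$ is $\mathcal U$-interpretable. The $B$-restricted quantifiers are semi-uniform if $B$ subsumes $\mathcal I_\sigma(x)$ and $B$ has no positive $\mathcal I$-witnesses (the tuple of positive witnesses of $|B(x,\boldsymbol y)|$ is empty).
   Formalization: The formal theorem additionally assumes that every witnessing type of the target theory has a closed term; without this, interpreting the prefix I(y) → … can fail because no closed term of the required type of non-empty finite sets exists. -}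

module Defs where

open import Data.List using (List; []; _∷_; _++_; map; foldr)
open import Data.List.Membership.Propositional using (_∈_)
open import Data.List.Membership.Propositional.Properties using (∈-++⁺ʳ)
open import Data.List.Relation.Unary.All as All using (All; []; _∷_)
open import Data.List.Relation.Unary.All.Properties using (map⁺; map⁻; ++⁺; ++⁻ˡ; ++⁻ʳ)
open import Data.List.Relation.Unary.Any using (here; there)
open import Data.Product using (Σ-syntax; _×_)
open import Relation.Binary.PropositionalEquality using (_≡_; refl)

-- Every type that is not ℕ, 𝔹 or a function type counts as a ground type;
-- in particular further type formers (such as finite subsets) live in G.

infixr 7 _⇒_

data Ty (G : Set) : Set where
  nat bool : Ty G
  ground   : G → Ty G
  _⇒_      : Ty G → Ty G → Ty G

extend : {G H : Set} → (G → Ty H) → Ty G → Ty H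
extend γ nat        = nat
extend γ bool       = bool
extend γ (ground g) = γ g
extend γ (σ ⇒ τ)    = extend γ σ ⇒ extend γ τ

record Signature : Set₁ where
  field
    Ground : Set
    Con    : Ty Ground → Set

open Signature public

data Core {G : Set} : Ty G → Set where
  𝐊    : ∀ {σ τ} → Core (σ ⇒ τ ⇒ σ)
  𝐒    : ∀ {ρ σ τ} → Core ((ρ ⇒ σ ⇒ τ) ⇒ (ρ ⇒ σ) ⇒ ρ ⇒ τ)
  O    : Core nat
  suc  : Core (nat ⇒ nat)
  rec  : ∀ {σ} → Core (σ ⇒ (nat ⇒ σ ⇒ σ) ⇒ nat ⇒ σ)
  tt   : Core bool
  ff   : Core bool
  cond : ∀ {σ} → Core (bool ⇒ σ ⇒ σ ⇒ σ)

extendCore : {G H : Set} (γ : G → Ty H) {σ : Ty G} → Core σ → Core (extend γ σ)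
extendCore γ 𝐊    = 𝐊
extendCore γ 𝐒    = 𝐒
extendCore γ O    = O
extendCore γ suc  = suc
extendCore γ rec  = rec
extendCore γ tt   = tt
extendCore γ ff   = ff
extendCore γ cond = cond

-- A context is a list of types; a variable is a (de Bruijn) position in it.

infixl 9 _·_

data Tm (𝕊 : Signature) (Γ : List (Ty (Ground 𝕊))) : Ty (Ground 𝕊) → Set where
  var  : ∀ {σ} → σ ∈ Γ → Tm 𝕊 Γ σ
  core : ∀ {σ} → Core σ → Tm 𝕊 Γ σ
  con  : ∀ {σ} → Con 𝕊 σ → Tm 𝕊 Γ σ
  _·_  : ∀ {σ τ} → Tm 𝕊 Γ (σ ⇒ τ) → Tm 𝕊 Γ σ → Tm 𝕊 Γ τ

Sub : (𝕊 : Signature) → List (Ty (Ground 𝕊)) → List (Ty (Ground 𝕊)) → Set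
Sub 𝕊 Γ Δ = All (Tm 𝕊 Δ) Γ

module _ {𝕊 : Signature} where

  infixl 10 _⟨_⟩ₜ

  _⟨_⟩ₜ : ∀ {Γ Δ σ} → Tm 𝕊 Γ σ → Sub 𝕊 Γ Δ → Tm 𝕊 Δ σ
  var x   ⟨ θ ⟩ₜ = All.lookup θ x
  core c  ⟨ θ ⟩ₜ = core c
  con c   ⟨ θ ⟩ₜ = con c
  (t · u) ⟨ θ ⟩ₜ = (t ⟨ θ ⟩ₜ) · (u ⟨ θ ⟩ₜ)

  idₛ : ∀ {Γ} → Sub 𝕊 Γ Γ
  idₛ = All.tabulate var

  wkₛ : ∀ {Γ σ} → Sub 𝕊 Γ (σ ∷ Γ)
  wkₛ = All.tabulate (λ x → var (there x))

  wks : ∀ Δ {Γ} → Sub 𝕊 Γ (Δ ++ Γ)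
  wks Δ = All.tabulate (λ x → var (∈-++⁺ʳ Δ x))

  lift : ∀ {Γ Δ σ} → Sub 𝕊 Γ Δ → Sub 𝕊 (σ ∷ Γ) (σ ∷ Δ)
  lift θ = var (here refl) ∷ All.map (_⟨ wkₛ ⟩ₜ) θ

  v₀ : ∀ {Γ ρ} → Tm 𝕊 (ρ ∷ Γ) ρ
  v₀ = var (here refl)

  v₁ : ∀ {Γ ρ σ} → Tm 𝕊 (σ ∷ ρ ∷ Γ) ρ
  v₁ = var (there (here refl))

  v₂ : ∀ {Γ ρ σ τ} → Tm 𝕊 (τ ∷ σ ∷ ρ ∷ Γ) ρ
  v₂ = var (there (there (here refl)))

  -- Truncated subtraction: n ∸ k iterates the predecessor k times on n,
  -- where pred = rec 0 (λ m _. m).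

  pred : ∀ {Γ} → Tm 𝕊 Γ (nat ⇒ nat)
  pred = core rec · core O · core 𝐊

  _∸̇_ : ∀ {Γ} → Tm 𝕊 Γ nat → Tm 𝕊 Γ nat → Tm 𝕊 Γ nat
  n ∸̇ k = core rec · n · (core 𝐊 · pred) · k

record Language : Set₁ where
  field
    sig : Signature
    Rel : List (Ty (Ground sig)) → Set

open Language public

Type : Language → Set
Type L = Ty (Ground (sig L))

Cxt : Language → Set
Cxt L = List (Type L)

data Quantifiers : Set where
  plain restricted : Quantifiers

-- In ∀◁ B A and ∃◁ B A the bound variable x is variable 0 of both B and A,
-- and the parameters of B are among the remaining variables.

infix  6 _≐_
infixr 5 _∧̇_
infixr 4 _⊃_

data Fm (L : Language) : Quantifiers → Cxt L → Set where
  ⊥̇    : ∀ {q Γ} → Fm L q Γ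
  _≐_  : ∀ {q Γ σ} → Tm (sig L) Γ σ → Tm (sig L) Γ σ → Fm L q Γ
  rel  : ∀ {q Γ σs} → Rel L σs → Sub (sig L) σs Γ → Fm L q Γ
  _∧̇_ _⊃_ : ∀ {q Γ} → Fm L q Γ → Fm L q Γ → Fm L q Γ
  ∀̇ ∃̇  : ∀ {q Γ σ} → Fm L q (σ ∷ Γ) → Fm L q Γ
  ∀◁ ∃◁ : ∀ {Γ σ} → Fm L restricted (σ ∷ Γ) → Fm L restricted (σ ∷ Γ) → Fm L restricted Γ

module _ {L : Language} where

  infixl 10 _⟨_⟩

  _⟨_⟩ : ∀ {q Γ Δ} → Fm L q Γ → Sub (sig L) Γ Δ → Fm L q Δ
  ⊥̇        ⟨ θ ⟩ = ⊥̇
  (t ≐ u)  ⟨ θ ⟩ = (t ⟨ θ ⟩ₜ) ≐ (u ⟨ θ ⟩ₜ)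
  rel R ts ⟨ θ ⟩ = rel R (All.map (_⟨ θ ⟩ₜ) ts)
  (A ∧̇ B)  ⟨ θ ⟩ = (A ⟨ θ ⟩) ∧̇ (B ⟨ θ ⟩)
  (A ⊃ B)  ⟨ θ ⟩ = (A ⟨ θ ⟩) ⊃ (B ⟨ θ ⟩)
  ∀̇ A      ⟨ θ ⟩ = ∀̇ (A ⟨ lift θ ⟩)
  ∃̇ A      ⟨ θ ⟩ = ∃̇ (A ⟨ lift θ ⟩)
  ∀◁ B A   ⟨ θ ⟩ = ∀◁ (B ⟨ lift θ ⟩) (A ⟨ lift θ ⟩)
  ∃◁ B A   ⟨ θ ⟩ = ∃◁ (B ⟨ lift θ ⟩) (A ⟨ lift θ ⟩)

  infix 6 _≤̇_
  infix 3 _⇔̇_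

  _≤̇_ : ∀ {q Γ} → Tm (sig L) Γ nat → Tm (sig L) Γ nat → Fm L q Γ
  n ≤̇ k = (n ∸̇ k) ≐ core O

  _⇔̇_ : ∀ {q Γ} → Fm L q Γ → Fm L q Γ → Fm L q Γ
  A ⇔̇ B = (A ⊃ B) ∧̇ (B ⊃ A)

  -- Disjunction is definable from existence and the Booleans.

  _∨̇_ : ∀ {q Γ} → Fm L q Γ → Fm L q Γ → Fm L q Γ
  A ∨̇ B = ∃̇ {σ = bool} ((v₀ ≐ core tt ⊃ A ⟨ wkₛ ⟩) ∧̇ (v₀ ≐ core ff ⊃ B ⟨ wkₛ ⟩))

  ∀⋆ : ∀ {q} Δ {Γ} → Fm L q (Δ ++ Γ) → Fm L q Γ
  ∀⋆ []      A = A
  ∀⋆ (σ ∷ Δ) A = ∀⋆ Δ (∀̇ A)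

  closure : ∀ {q} Γ → Fm L q Γ → Fm L q []
  closure []      A = A
  closure (σ ∷ Γ) A = closure Γ (∀̇ A)

-- Intuitionistic logic with equality over a set Ax of axioms (sentences).
-- Derivability is relative to a context of free variables, so that no type is
-- presupposed to be inhabited.

infix 2 _∣_⊢_

data _∣_⊢_ {L : Language} {q : Quantifiers} (Ax : Fm L q [] → Set) {Γ : Cxt L}
           (Ψ : List (Fm L q Γ)) : Fm L q Γ → Set where
  ax  : ∀ {A} → Ax A → Ax ∣ Ψ ⊢ A ⟨ [] ⟩
  hyp : ∀ {A} → A ∈ Ψ → Ax ∣ Ψ ⊢ A
  ⊥E  : ∀ {A} → Ax ∣ Ψ ⊢ ⊥̇ → Ax ∣ Ψ ⊢ A
  ∧I  : ∀ {A B} → Ax ∣ Ψ ⊢ A → Ax ∣ Ψ ⊢ B → Ax ∣ Ψ ⊢ A ∧̇ B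
  ∧E₁ : ∀ {A B} → Ax ∣ Ψ ⊢ A ∧̇ B → Ax ∣ Ψ ⊢ A
  ∧E₂ : ∀ {A B} → Ax ∣ Ψ ⊢ A ∧̇ B → Ax ∣ Ψ ⊢ B
  ⊃I  : ∀ {A B} → Ax ∣ (A ∷ Ψ) ⊢ B → Ax ∣ Ψ ⊢ A ⊃ B
  ⊃E  : ∀ {A B} → Ax ∣ Ψ ⊢ A ⊃ B → Ax ∣ Ψ ⊢ A → Ax ∣ Ψ ⊢ B
  ∀I  : ∀ {σ} {A : Fm L q (σ ∷ Γ)} → Ax ∣ map (_⟨ wkₛ ⟩) Ψ ⊢ A → Ax ∣ Ψ ⊢ ∀̇ A
  ∀E  : ∀ {σ} {A : Fm L q (σ ∷ Γ)} → Ax ∣ Ψ ⊢ ∀̇ A → (t : Tm (sig L) Γ σ) →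
        Ax ∣ Ψ ⊢ A ⟨ t ∷ idₛ ⟩
  ∃I  : ∀ {σ} {A : Fm L q (σ ∷ Γ)} (t : Tm (sig L) Γ σ) → Ax ∣ Ψ ⊢ A ⟨ t ∷ idₛ ⟩ →
        Ax ∣ Ψ ⊢ ∃̇ A
  ∃E  : ∀ {σ} {A : Fm L q (σ ∷ Γ)} {B} → Ax ∣ Ψ ⊢ ∃̇ A →
        Ax ∣ (A ∷ map (_⟨ wkₛ ⟩) Ψ) ⊢ B ⟨ wkₛ ⟩ → Ax ∣ Ψ ⊢ B
  ≐I  : ∀ {σ} {t : Tm (sig L) Γ σ} → Ax ∣ Ψ ⊢ t ≐ t
  ≐E  : ∀ {σ} (A : Fm L q (σ ∷ Γ)) {t u : Tm (sig L) Γ σ} → Ax ∣ Ψ ⊢ t ≐ u →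
        Ax ∣ Ψ ⊢ A ⟨ t ∷ idₛ ⟩ → Ax ∣ Ψ ⊢ A ⟨ u ∷ idₛ ⟩

infix 2 _⊢_

_⊢_ : ∀ {L q} → (Fm L q [] → Set) → ∀ {Γ} → Fm L q Γ → Set
Ax ⊢ A = Ax ∣ [] ⊢ A

-- ∀◁-eq and ∃◁-eq exist only for languages with restricted quantifiers; for the
-- others (the target) this is the usual arithmetic of 0, suc, recursors, Booleans.

data HAω {L : Language} : {q : Quantifiers} → Fm L q [] → Set where
  𝐊-eq : ∀ {q σ τ} →
    HAω {q = q} (closure (τ ∷ σ ∷ []) (core 𝐊 · v₁ · v₀ ≐ v₁))
  𝐒-eq : ∀ {q ρ σ τ} →
    HAω {q = q} (closure (ρ ∷ (ρ ⇒ σ) ∷ (ρ ⇒ σ ⇒ τ) ∷ [])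
                         (core 𝐒 · v₂ · v₁ · v₀ ≐ v₂ · v₀ · (v₁ · v₀)))
  rec-O : ∀ {q σ} →
    HAω {q = q} (closure ((nat ⇒ σ ⇒ σ) ∷ σ ∷ []) (core rec · v₁ · v₀ · core O ≐ v₁))
  rec-suc : ∀ {q σ} →
    HAω {q = q} (closure (nat ∷ (nat ⇒ σ ⇒ σ) ∷ σ ∷ [])
                         (core rec · v₂ · v₁ · (core suc · v₀)
                            ≐ v₁ · v₀ · (core rec · v₂ · v₁ · v₀)))
  cond-tt : ∀ {q σ} →
    HAω {q = q} (closure (σ ∷ σ ∷ []) (core cond · core tt · v₁ · v₀ ≐ v₁))
  cond-ff : ∀ {q σ} →
    HAω {q = q} (closure (σ ∷ σ ∷ []) (core cond · core ff · v₁ · v₀ ≐ v₀))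
  suc≢O : ∀ {q} →
    HAω {q = q} (closure (nat ∷ []) (core suc · v₀ ≐ core O ⊃ ⊥̇))
  suc-injective : ∀ {q} →
    HAω {q = q} (closure (nat ∷ nat ∷ []) (core suc · v₁ ≐ core suc · v₀ ⊃ v₁ ≐ v₀))
  induction : ∀ {q Γ} (A : Fm L q (nat ∷ Γ)) →
    HAω (closure Γ (A ⟨ core O ∷ idₛ ⟩ ⊃ ∀̇ (A ⊃ A ⟨ (core suc · v₀) ∷ wkₛ ⟩) ⊃ ∀̇ A))
  tt≢ff : ∀ {q} →
    HAω {q = q} (core tt ≐ core ff ⊃ ⊥̇)
  bool-cases : ∀ {q Γ} (A : Fm L q (bool ∷ Γ)) →
    HAω (closure Γ (A ⟨ core tt ∷ idₛ ⟩ ⊃ A ⟨ core ff ∷ idₛ ⟩ ⊃ ∀̇ A))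
  ∀◁-eq : ∀ {Γ σ} (B A : Fm L restricted (σ ∷ Γ)) →
    HAω (closure Γ (∀◁ B A ⇔̇ ∀̇ (B ⊃ A)))
  ∃◁-eq : ∀ {Γ σ} (B A : Fm L restricted (σ ∷ Γ)) →
    HAω (closure Γ (∃◁ B A ⇔̇ ∃̇ (B ∧̇ A)))

record ExtensionOfHAω : Set₁ where
  field
    𝓛          : Language
    Axiom      : Fm 𝓛 restricted [] → Set
    proves-HAω : ∀ {A} → HAω A → Axiom ⊢ A

record WitTy {H : Set} (W : Ty H → Set) : Set where
  constructor _by_
  field
    type          : Ty H
    .isWitnessing : W type

open WitTy public

-- Source types and terms are included in the target by interpreting ground
-- types as target types and constants as closed target terms; 'groundType' and
-- 'constant' may thus identify source symbols with ones the target already has.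

record TargetLanguage (L : Language) : Set₁ where
  field
    target     : Language
    groundType : Ground (sig L) → Type target
    constant   : ∀ {σ} → Con (sig L) σ → Tm (sig target) [] (extend groundType σ)

    Witnessing   : Type target → Set
    _⋆           : Type target → Type target
    nat-witness  : Witnessing nat
    ⇒-witness    : ∀ {ρ τ} → Witnessing ρ → Witnessing τ → Witnessing (ρ ⇒ τ)
    ⋆-witness    : ∀ {ρ} → Witnessing ρ → Witnessing (ρ ⋆)

  ⌜_⌝ : Type L → Type target
  ⌜_⌝ = extend groundType

  Wit : Set
  Wit = WitTy Witnessing

  natʷ : Wit
  natʷ = nat by nat-witness

  infixr 7 _⇒ʷ_
  infixl 8 _⋆ʷ

  _⇒ʷ_ : Wit → Wit → Wit
  (ρ by p) ⇒ʷ (τ by q) = (ρ ⇒ τ) by ⇒-witness p q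

  _⋆ʷ : Wit → Wit
  (ρ by p) ⋆ʷ = (ρ ⋆) by ⋆-witness p

  field
    singleton    : (ρ : Wit)   → Con (sig target) (type ρ ⇒ type ρ ⋆)
    union        : (ρ : Wit)   → Con (sig target) (type ρ ⋆ ⇒ type ρ ⋆ ⇒ type ρ ⋆)
    indexedUnion : (ρ τ : Wit) → Con (sig target) (type ρ ⋆ ⇒ (type ρ ⇒ type τ ⋆) ⇒ type τ ⋆)
    maximum      : Con (sig target) (nat ⋆ ⇒ nat)
    membership   : (ρ : Wit)   → Rel target (type ρ ∷ type ρ ⋆ ∷ [])

  mem : ∀ {Γ} (ρ : Wit) → Tm (sig target) Γ (type ρ) → Tm (sig target) Γ (type ρ ⋆) →
        Fm target plain Γ
  mem ρ t A = rel (membership ρ) (t ∷ A ∷ [])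

-- Neither extensionality nor an induction principle for finite subsets is
-- demanded of the target theory.

module _ {L : Language} (𝕋 : TargetLanguage L) where
  open TargetLanguage 𝕋

  data FiniteSubsetFact : Fm target plain [] → Set where
    inhabited : (ρ : Wit) →
      FiniteSubsetFact (closure (type ρ ⋆ ∷ []) (∃̇ (mem ρ v₀ v₁)))
    mem-singleton : (ρ : Wit) →
      FiniteSubsetFact (closure (type ρ ∷ type ρ ∷ [])
        (mem ρ v₁ (con (singleton ρ) · v₀) ⇔̇ v₁ ≐ v₀))
    mem-union : (ρ : Wit) →
      FiniteSubsetFact (closure (type ρ ∷ type ρ ⋆ ∷ type ρ ⋆ ∷ [])
        (mem ρ v₀ (con (union ρ) · v₂ · v₁) ⇔̇ (mem ρ v₀ v₂ ∨̇ mem ρ v₀ v₁)))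
    mem-indexedUnion : (ρ τ : Wit) →
      FiniteSubsetFact (closure (type τ ∷ (type ρ ⇒ type τ ⋆) ∷ type ρ ⋆ ∷ [])
        (mem τ v₀ (con (indexedUnion ρ τ) · v₂ · v₁)
          ⇔̇ ∃̇ (mem ρ v₀ (v₂ ⟨ wkₛ ⟩ₜ) ∧̇ mem τ v₁ (v₂ · v₀))))
    maximum-mem :
      FiniteSubsetFact (closure (nat ⋆ ∷ []) (mem natʷ (con maximum · v₀) v₀))
    maximum-bound :
      FiniteSubsetFact (closure (nat ∷ nat ⋆ ∷ [])
        (mem natʷ v₀ v₁ ⊃ v₀ ≤̇ con maximum · v₁))

-- Every witnessing type has a closed term: the interpretation of an implication
-- needs some finite set of negative witnesses for the premise, and ρ ⋆
-- consists of non-empty sets.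

record TargetTheory (L : Language) : Set₁ where
  field
    𝕋 : TargetLanguage L
  open TargetLanguage 𝕋 public
  field
    Axiom         : Fm target plain [] → Set
    proves-HAω    : ∀ {A} → HAω A → Axiom ⊢ A
    proves-⋆      : ∀ {A} → FiniteSubsetFact 𝕋 A → Axiom ⊢ A
    inhabitant    : (ρ : Wit) → Tm (sig target) [] (type ρ)

data Rel𝓘 (L : Language) : Cxt L → Set where
  rel : ∀ {σs} → Rel L σs → Rel𝓘 L σs
  𝓘   : ∀ σ → Rel𝓘 L (σ ∷ [])

_with𝓘 : Language → Language
L with𝓘 = record { sig = sig L ; Rel = Rel𝓘 L }

module _ {L : Language} where

  In : ∀ {Γ σ} → Tm (sig L) Γ σ → Fm (L with𝓘) plain Γ
  In {σ = σ} t = rel (𝓘 σ) (t ∷ [])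

  infixl 10 _^𝓘

  _^𝓘 : ∀ {q Γ} → Fm L q Γ → Fm (L with𝓘) plain Γ
  ⊥̇          ^𝓘 = ⊥̇
  (t ≐ u)    ^𝓘 = t ≐ u
  (rel R ts) ^𝓘 = rel (rel R) ts
  (A ∧̇ B)    ^𝓘 = (A ^𝓘) ∧̇ (B ^𝓘)
  (A ⊃ B)    ^𝓘 = (A ^𝓘) ⊃ (B ^𝓘)
  (∀̇ A)      ^𝓘 = ∀̇ (In v₀ ⊃ A ^𝓘)
  (∃̇ A)      ^𝓘 = ∃̇ (In v₀ ∧̇ A ^𝓘)
  (∀◁ B A)   ^𝓘 = ∀̇ (B ^𝓘 ⊃ A ^𝓘)
  (∃◁ B A)   ^𝓘 = ∃̇ (B ^𝓘 ∧̇ A ^𝓘)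

  -- ∀ 𝐱 (𝓘(𝐱) → A), curried: ∀ x₁ (𝓘(x₁) → … ∀ xₙ (𝓘(xₙ) → A) …).

  closure𝓘 : ∀ Γ → Fm (L with𝓘) plain Γ → Fm (L with𝓘) plain []
  closure𝓘 []      A = A
  closure𝓘 (σ ∷ Γ) A = closure𝓘 Γ (∀̇ (In v₀ ⊃ A))

module _ {L : Language} (T : TargetTheory L) where
  open TargetTheory T

  -- The formula ⟨R(𝐱)⟩ᶜ_d, with free variables 𝐱, 𝐜, 𝐝 in this order.

  record AtomInterpretation (σs : Cxt L) : Set where
    field
      pos neg : List Wit
      formula : Fm target plain (map ⌜_⌝ σs ++ map type pos ++ map type neg)

  record BaseInterpretation : Set where
    field
      atom : ∀ {σs} → Rel𝓘 L σs → AtomInterpretation σs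

  bounding : AtomInterpretation (nat ∷ [])
  bounding = record { pos = natʷ ∷ [] ; neg = [] ; formula = v₀ ≤̇ v₁ }

  UsesBoundingAtℕ : BaseInterpretation → Set
  UsesBoundingAtℕ β = BaseInterpretation.atom β (𝓘 nat) ≡ bounding

  Tms : Cxt target → List Wit → Set
  Tms Δ = All (λ ρ → Tm (sig target) Δ (type ρ))

  arrow : List Wit → Wit → Wit
  arrow ρs τ = foldr _⇒ʷ_ τ ρs

  app : ∀ {Δ} ρs {τ} → Tm (sig target) Δ (type (arrow ρs τ)) → Tms Δ ρs →
        Tm (sig target) Δ (type τ)
  app []       t []       = t
  app (ρ ∷ ρs) t (u ∷ us) = app ρs (t · u) us

  apply : ∀ {Δ} ρs {τs} → Tms Δ (map (arrow ρs) τs) → Tms Δ ρs → Tms Δ τs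
  apply ρs {[]}     []       us = []
  apply ρs {τ ∷ τs} (t ∷ ts) us = app ρs {τ} t us ∷ apply ρs ts us

  wkTms : ∀ Ξ {Δ ρs} → Tms Δ ρs → Tms (Ξ ++ Δ) ρs
  wkTms Ξ = All.map (_⟨ wks Ξ ⟩ₜ)

  vars : ∀ ρs {Δ} → Tms (map type ρs ++ Δ) ρs
  vars []       = []
  vars (ρ ∷ ρs) = v₀ ∷ All.map (_⟨ wkₛ ⟩ₜ) (vars ρs)

  -- ∀ 𝐛 ∈ 𝐁, componentwise.

  ∀∈ : ∀ {Δ} ρs → Tms Δ (map _⋆ʷ ρs) → Fm target plain (map type ρs ++ Δ) →
       Fm target plain Δ
  ∀∈ []       []       A = A
  ∀∈ (ρ ∷ ρs) (B ∷ Bs) A = ∀∈ ρs Bs (∀̇ (mem ρ v₀ (B ⟨ wks (type ρ ∷ map type ρs) ⟩ₜ) ⊃ A))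

  -- An environment assigns target terms to source variables.

  Env : Cxt L → Cxt target → Set
  Env Γ Δ = All (λ σ → Tm (sig target) Δ ⌜ σ ⌝) Γ

  wkEnv : ∀ Ξ {Γ Δ} → Env Γ Δ → Env Γ (Ξ ++ Δ)
  wkEnv Ξ = All.map (_⟨ wks Ξ ⟩ₜ)

  liftEnv : ∀ {Γ Δ} σ → Env Γ Δ → Env (σ ∷ Γ) (⌜ σ ⌝ ∷ Δ)
  liftEnv σ η = v₀ ∷ wkEnv (⌜ σ ⌝ ∷ []) η

  ⟦_⟧ : ∀ {Γ Δ σ} → Tm (sig L) Γ σ → Env Γ Δ → Tm (sig target) Δ ⌜ σ ⌝
  ⟦ var x ⟧  η = All.lookup η x
  ⟦ core c ⟧ η = core (extendCore groundType c)
  ⟦ con c ⟧  η = constant c ⟨ [] ⟩ₜ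
  ⟦ t · u ⟧  η = ⟦ t ⟧ η · ⟦ u ⟧ η

  module _ (β : BaseInterpretation) where
    open BaseInterpretation β

    mutual
      pos : ∀ {Γ} → Fm (L with𝓘) plain Γ → List Wit
      pos ⊥̇         = []
      pos (t ≐ u)   = []
      pos (rel R _) = AtomInterpretation.pos (atom R)
      pos (A ∧̇ B)   = pos A ++ pos B
      pos (A ⊃ B)   = map (arrow (pos A)) (pos B)
                      ++ map (arrow (pos A)) (map (arrow (neg B)) (map _⋆ʷ (neg A)))
      pos (∀̇ A)     = pos A
      pos (∃̇ A)     = pos A

      neg : ∀ {Γ} → Fm (L with𝓘) plain Γ → List Wit
      neg ⊥̇         = []
      neg (t ≐ u)   = []
      neg (rel R _) = AtomInterpretation.neg (atom R)
      neg (A ∧̇ B)   = neg A ++ neg B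
      neg (A ⊃ B)   = pos A ++ neg B
      neg (∀̇ A)     = neg A
      neg (∃̇ A)     = map _⋆ʷ (neg A)

    -- ⟪ A ⟫ η a b is ⟨A⟩ᵃ_b with the free source variables of A read by η.

    ⟪_⟫ : ∀ {Γ Δ} (A : Fm (L with𝓘) plain Γ) → Env Γ Δ → Tms Δ (pos A) → Tms Δ (neg A) →
          Fm target plain Δ
    ⟪ ⊥̇ ⟫        η a b = ⊥̇
    ⟪ t ≐ u ⟫    η a b = ⟦ t ⟧ η ≐ ⟦ u ⟧ η
    ⟪ rel R ts ⟫ η a b =
      AtomInterpretation.formula (atom R)
        ⟨ ++⁺ (map⁺ (All.map (λ t → ⟦ t ⟧ η) ts)) (++⁺ (map⁺ a) (map⁺ b)) ⟩
    ⟪ A ∧̇ B ⟫    η a b =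
      ⟪ A ⟫ η (++⁻ˡ (pos A) a) (++⁻ˡ (neg A) b)
        ∧̇ ⟪ B ⟫ η (++⁻ʳ (pos A) a) (++⁻ʳ (neg A) b)
    ⟪ A ⊃ B ⟫    η fg ad =
      ∀∈ (neg A) gad (⟪ A ⟫ (wkEnv Ξ η) (wkTms Ξ a) (vars (neg A))) ⊃ ⟪ B ⟫ η fa d
      where
      Ξ   = map type (neg A)
      a   = ++⁻ˡ (pos A) ad
      d   = ++⁻ʳ (pos A) ad
      fs  = map (arrow (pos A)) (pos B)
      fa  = apply (pos A) (++⁻ˡ fs fg) a
      gad = apply (neg B) (apply (pos A) (++⁻ʳ fs fg) a) d
    ⟪ ∀̇ {σ = σ} A ⟫ η a b = ∀̇ (⟪ A ⟫ (liftEnv σ η) (wkTms (⌜ σ ⌝ ∷ []) a) (wkTms (⌜ σ ⌝ ∷ []) b))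
    ⟪ ∃̇ {σ = σ} A ⟫ η a b =
      ∃̇ (∀∈ (neg A) (wkTms (⌜ σ ⌝ ∷ []) b)
            (⟪ A ⟫ (wkEnv Ξ (liftEnv σ η)) (wkTms Ξ (wkTms (⌜ σ ⌝ ∷ []) a)) (vars (neg A))))
      where
      Ξ = map type (neg A)

    sourceVars : ∀ Γ → Env Γ (map ⌜_⌝ Γ)
    sourceVars Γ = map⁻ idₛ

    UInterpretable : ∀ {Γ} → Fm (L with𝓘) plain Γ → Set
    UInterpretable {Γ} A =
      Σ[ t ∈ Tms [] (pos A) ]
        (Axiom ⊢ ∀⋆ Ξ (⟪ A ⟫ (wkEnv Ξ (sourceVars Γ)) (All.map (_⟨ [] ⟩ₜ) t) (vars (neg A))))
      where
      Ξ = map type (neg A)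

    𝓘-Interpretable : ∀ {q Γ} → Fm L q Γ → Set
    𝓘-Interpretable {Γ = Γ} A = UInterpretable (closure𝓘 Γ (A ^𝓘))

    Subsumes𝓘 : ∀ {q Y σ} → Fm L q (σ ∷ Y) → Set
    Subsumes𝓘 {Y = Y} B = UInterpretable (closure𝓘 Y (∀̇ (B ^𝓘 ⊃ In v₀)))

    SemiUniform : ∀ {q Y σ} → Fm L q (σ ∷ Y) → Set
    SemiUniform B = Subsumes𝓘 B × pos (B ^𝓘) ≡ []

-- The parameters of B are Y; those of C are Y and the further parameters Z.
-- Variables are listed innermost first: B(x, y) and C(n, x, z, y).

collection : ∀ {L σ} {Y : Cxt L} (Z : Cxt L) → Fm L restricted (σ ∷ Y) →
             Fm L restricted (nat ∷ σ ∷ Z ++ Y) → Fm L restricted (Z ++ Y)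
collection Z B C =
  ∀◁ B₁ (∃̇ C) ⊃ ∃̇ (∀◁ (B₁ ⟨ lift wkₛ ⟩) (∃◁ (v₀ ≤̇ v₂) (C ⟨ lift (lift wkₛ) ⟩)))
  where
  B₁ = B ⟨ lift (wks Z) ⟩

{-# OPTIONS --safe #-}
module Submission where

-- Since B has no positive witnesses, the premise supplies a single m bounding an
-- n for every x, and the conclusion holds with k = m. With this k the matrices of
-- premise and conclusion coincide. Hence the positive witnesses of the premise
-- serve for the conclusion, the finite sets of negative witnesses given for the
-- conclusion serve for the premise, and the principle is realized by projections.

open import Defs
open import Data.List using (List; []; _∷_; _++_; map)
open import Data.List.Membership.Propositional using (_∈_)
open import Data.List.Membership.Propositional.Properties using (∈-map⁺; ∈-map⁻; ∈-++⁺ʳ)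
open import Data.List.Relation.Unary.All as All using (All; []; _∷_)
open import Data.List.Relation.Unary.All.Properties using (map⁺; ++⁺; ++⁻ˡ; ++⁻ʳ; lookup-map)
open import Data.List.Relation.Unary.Any using (here; there)
open import Data.Product using (Σ-syntax; _,_)
open import Function using (_∘_)
open import Relation.Binary.PropositionalEquality

-- Two obstacles shape the proof. First, witness types are computed from formulas, and the principle
-- contains `B` and `C` in several substituted copies whose witness types agree with the original
-- ones only propositionally. Therefore the interpretation is replayed on `Interp`, which carries
-- its witness types as data, and source substitution becomes `reindex`, which leaves them
-- untouched. There the positive types of `B` are a variable that can be matched with the empty
-- list, and from then on the positive witness types of premise and conclusion agree by computation.
-- Second, the target has combinators instead of abstraction, and their equations are only provable.
-- A realizer applied to its arguments is thus never convertible to the intended tuple, and the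
-- argument must pass through provable replacement of whole tuples, both as witnesses and as bounds
-- of `∀∈`.

lookup-injective : ∀ {A : Set} {P : A → Set} {xs} {ps qs : All P xs} →
  (∀ {x} (i : x ∈ xs) → All.lookup ps i ≡ All.lookup qs i) → ps ≡ qs
lookup-injective {ps = []}    {[]}    h = refl
lookup-injective {ps = _ ∷ _} {_ ∷ _} h =
  cong₂ _∷_ (h (here refl)) (lookup-injective (h ∘ there))

lookup-tabulate : ∀ {A : Set} {P : A → Set} {xs} (f : ∀ {x} → x ∈ xs → P x) {x} (i : x ∈ xs) →
  All.lookup (All.tabulate f) i ≡ f i
lookup-tabulate f (here refl) = refl
lookup-tabulate f (there i)   = lookup-tabulate (f ∘ there) i

module _ {A : Set} {P Q : A → Set} (f : ∀ {x} → P x → Q x) where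

  map-++⁺ : ∀ {xs ys} (ps : All P xs) (qs : All P ys) →
    All.map f (++⁺ ps qs) ≡ ++⁺ (All.map f ps) (All.map f qs)
  map-++⁺ []       qs = refl
  map-++⁺ (p ∷ ps) qs = cong (f p ∷_) (map-++⁺ ps qs)

  map-++⁻ˡ : ∀ xs {ys} (ps : All P (xs ++ ys)) →
    All.map f (++⁻ˡ xs ps) ≡ ++⁻ˡ xs (All.map f ps)
  map-++⁻ˡ []       ps       = refl
  map-++⁻ˡ (x ∷ xs) (p ∷ ps) = cong (f p ∷_) (map-++⁻ˡ xs ps)

  map-++⁻ʳ : ∀ xs {ys} (ps : All P (xs ++ ys)) →
    All.map f (++⁻ʳ xs ps) ≡ ++⁻ʳ xs (All.map f ps)
  map-++⁻ʳ []       ps       = refl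
  map-++⁻ʳ (x ∷ xs) (p ∷ ps) = map-++⁻ʳ xs ps

module _ {A : Set} {P : A → Set} where

  ++⁻ˡ-++⁺ : ∀ {xs ys} (ps : All P xs) (qs : All P ys) → ++⁻ˡ xs (++⁺ ps qs) ≡ ps
  ++⁻ˡ-++⁺ []       qs = refl
  ++⁻ˡ-++⁺ (p ∷ ps) qs = cong (p ∷_) (++⁻ˡ-++⁺ ps qs)

  ++⁻ʳ-++⁺ : ∀ {xs ys} (ps : All P xs) (qs : All P ys) → ++⁻ʳ xs (++⁺ ps qs) ≡ qs
  ++⁻ʳ-++⁺ []       qs = refl
  ++⁻ʳ-++⁺ (p ∷ ps) qs = ++⁻ʳ-++⁺ ps qs

-- The type former f covers substitutions (f = id), tuples of witnesses
-- (f = type) and environments (f = ⌜_⌝) at once.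

infixl 10 _✶_

_✶_ : ∀ {𝕊 Γ Δ} {A : Set} {f : A → Ty (Ground 𝕊)} {xs : List A} →
  All (λ x → Tm 𝕊 Γ (f x)) xs → Sub 𝕊 Γ Δ → All (λ x → Tm 𝕊 Δ (f x)) xs
ts ✶ θ = All.map (_⟨ θ ⟩ₜ) ts

-- Substitution algebra for terms and tuples

module _ {𝕊 : Signature} where

  ⟨⟩ₜ-✶ : ∀ {Γ Δ Θ σ} (t : Tm 𝕊 Γ σ) (θ : Sub 𝕊 Γ Δ) (ξ : Sub 𝕊 Δ Θ) →
    t ⟨ θ ⟩ₜ ⟨ ξ ⟩ₜ ≡ t ⟨ θ ✶ ξ ⟩ₜ
  ⟨⟩ₜ-✶ (var x)  θ ξ = sym (lookup-map θ x)
  ⟨⟩ₜ-✶ (core c) θ ξ = refl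
  ⟨⟩ₜ-✶ (con c)  θ ξ = refl
  ⟨⟩ₜ-✶ (t · u)  θ ξ = cong₂ _·_ (⟨⟩ₜ-✶ t θ ξ) (⟨⟩ₜ-✶ u θ ξ)

  ⟨⟩ₜ-id : ∀ {Γ σ} (t : Tm 𝕊 Γ σ) → t ⟨ idₛ ⟩ₜ ≡ t
  ⟨⟩ₜ-id (var x)  = lookup-tabulate var x
  ⟨⟩ₜ-id (core c) = refl
  ⟨⟩ₜ-id (con c)  = refl
  ⟨⟩ₜ-id (t · u)  = cong₂ _·_ (⟨⟩ₜ-id t) (⟨⟩ₜ-id u)

  module _ {A : Set} {f : A → Ty (Ground 𝕊)} where

    ✶-✶ : ∀ {Γ Δ Θ} {xs : List A} (ts : All (λ x → Tm 𝕊 Γ (f x)) xs) (θ : Sub 𝕊 Γ Δ)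
      (ξ : Sub 𝕊 Δ Θ) → ts ✶ θ ✶ ξ ≡ ts ✶ (θ ✶ ξ)
    ✶-✶ []       θ ξ = refl
    ✶-✶ (t ∷ ts) θ ξ = cong₂ _∷_ (⟨⟩ₜ-✶ t θ ξ) (✶-✶ ts θ ξ)

    ✶-id : ∀ {Γ} {xs : List A} (ts : All (λ x → Tm 𝕊 Γ (f x)) xs) → ts ✶ idₛ ≡ ts
    ✶-id []       = refl
    ✶-id (t ∷ ts) = cong₂ _∷_ (⟨⟩ₜ-id t) (✶-id ts)

    -- Commutation laws are proved once for substitutions and carried over to tuples in this form;
    -- `⟨⟩ₜ-square` and `⟨⟩-square` do the same for terms and formulas.
    ✶-square : ∀ {Γ Δ Δ′ Θ} {xs : List A} (ts : All (λ x → Tm 𝕊 Γ (f x)) xs)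
      {θ : Sub 𝕊 Γ Δ} {ξ : Sub 𝕊 Δ Θ} {θ′ : Sub 𝕊 Γ Δ′} {ξ′ : Sub 𝕊 Δ′ Θ} →
      θ ✶ ξ ≡ θ′ ✶ ξ′ → ts ✶ θ ✶ ξ ≡ ts ✶ θ′ ✶ ξ′
    ✶-square ts e = trans (✶-✶ ts _ _) (trans (cong (ts ✶_) e) (sym (✶-✶ ts _ _)))

    ✶-retract : ∀ {Γ Δ} {xs : List A} (ts : All (λ x → Tm 𝕊 Γ (f x)) xs)
      {θ : Sub 𝕊 Γ Δ} {ξ : Sub 𝕊 Δ Γ} → θ ✶ ξ ≡ idₛ → ts ✶ θ ✶ ξ ≡ ts
    ✶-retract ts e = trans (✶-✶ ts _ _) (trans (cong (ts ✶_) e) (✶-id ts))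

  ⟨⟩ₜ-square : ∀ {Γ Δ Δ′ Θ σ} (t : Tm 𝕊 Γ σ)
    {θ : Sub 𝕊 Γ Δ} {ξ : Sub 𝕊 Δ Θ} {θ′ : Sub 𝕊 Γ Δ′} {ξ′ : Sub 𝕊 Δ′ Θ} →
    θ ✶ ξ ≡ θ′ ✶ ξ′ → t ⟨ θ ⟩ₜ ⟨ ξ ⟩ₜ ≡ t ⟨ θ′ ⟩ₜ ⟨ ξ′ ⟩ₜ
  ⟨⟩ₜ-square t e = trans (⟨⟩ₜ-✶ t _ _) (trans (cong (t ⟨_⟩ₜ) e) (sym (⟨⟩ₜ-✶ t _ _)))

  -- `idₛ`, `wkₛ` and `wks` are tabulated and do not compute on an unknown context, so the
  -- comparison goes position by position.
  tabulate-✶ : ∀ {Γ Δ Θ} (f : ∀ {σ} → σ ∈ Γ → σ ∈ Δ) (θ : Sub 𝕊 Δ Θ) →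
    All.tabulate (λ x → var (f x)) ✶ θ ≡ All.tabulate (λ x → All.lookup θ (f x))
  tabulate-✶ f θ = lookup-injective λ i →
    trans (lookup-map (All.tabulate (λ x → var (f x))) i)
      (trans (cong (_⟨ θ ⟩ₜ) (lookup-tabulate (λ x → var (f x)) i))
        (sym (lookup-tabulate (λ x → All.lookup θ (f x)) i)))

  tabulate-lookup : ∀ {Γ Δ} (θ : Sub 𝕊 Γ Δ) → All.tabulate (All.lookup θ) ≡ θ
  tabulate-lookup θ = lookup-injective (lookup-tabulate (All.lookup θ))

  id-✶ : ∀ {Γ Δ} (θ : Sub 𝕊 Γ Δ) → idₛ ✶ θ ≡ θ
  id-✶ θ = trans (tabulate-✶ (λ x → x) θ) (tabulate-lookup θ)

  wkₛ-✶ : ∀ {Γ Δ σ} (t : Tm 𝕊 Δ σ) (θ : Sub 𝕊 Γ Δ) → wkₛ ✶ (t ∷ θ) ≡ θ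
  wkₛ-✶ t θ = trans (tabulate-✶ there (t ∷ θ)) (tabulate-lookup θ)

  wkₜ-∷ : ∀ {Γ σ τ} (t : Tm 𝕊 Γ τ) (u : Tm 𝕊 Γ σ) → t ⟨ wkₛ ⟩ₜ ⟨ u ∷ idₛ ⟩ₜ ≡ t
  wkₜ-∷ t u = trans (⟨⟩ₜ-✶ t _ _) (trans (cong (t ⟨_⟩ₜ) (wkₛ-✶ u idₛ)) (⟨⟩ₜ-id t))

  wks-✶-wkₛ : ∀ Ξ {Γ σ} → wks {𝕊} Ξ {Γ} ✶ wkₛ {σ = σ} ≡ wks (σ ∷ Ξ)
  wks-✶-wkₛ Ξ {σ = σ} = lookup-injective λ i →
    trans (lookup-map (wks Ξ) i)
      (trans (cong (_⟨ wkₛ ⟩ₜ) (lookup-tabulate (λ x → var (∈-++⁺ʳ Ξ x)) i))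
        (trans (lookup-tabulate (λ x → var (there x)) (∈-++⁺ʳ Ξ i))
          (sym (lookup-tabulate (λ x → var (∈-++⁺ʳ (σ ∷ Ξ) x)) i))))

  wks-++⁺ : ∀ {Ξ Γ Δ} (ξ : Sub 𝕊 Ξ Δ) (θ : Sub 𝕊 Γ Δ) → wks Ξ ✶ ++⁺ ξ θ ≡ θ
  wks-++⁺             []      θ = id-✶ θ
  wks-++⁺ {Ξ = _ ∷ Ξ} (t ∷ ξ) θ =
    trans (cong (_✶ (t ∷ ++⁺ ξ θ)) (sym (wks-✶-wkₛ Ξ)))
      (trans (✶-✶ (wks Ξ) _ _) (trans (cong (wks Ξ ✶_) (wkₛ-✶ t _)) (wks-++⁺ ξ θ)))

  wk-lift : ∀ {Γ Δ σ} (θ : Sub 𝕊 Γ Δ) → wkₛ {σ = σ} ✶ lift θ ≡ θ ✶ wkₛ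
  wk-lift θ = wkₛ-✶ v₀ (θ ✶ wkₛ)

  lift-∷ : ∀ {Γ Δ Θ σ} (θ : Sub 𝕊 Γ Δ) (t : Tm 𝕊 Θ σ) (ξ : Sub 𝕊 Δ Θ) →
    lift θ ✶ (t ∷ ξ) ≡ t ∷ θ ✶ ξ
  lift-∷ θ t ξ = cong (t ∷_) (trans (✶-✶ θ _ _) (cong (θ ✶_) (wkₛ-✶ t ξ)))

  ∷-lift : ∀ {Γ Δ σ} (t : Tm 𝕊 Γ σ) (θ : Sub 𝕊 Γ Δ) →
    (t ∷ idₛ) ✶ θ ≡ lift θ ✶ (t ⟨ θ ⟩ₜ ∷ idₛ)
  ∷-lift t θ = trans (cong (t ⟨ θ ⟩ₜ ∷_) (trans (id-✶ θ) (sym (✶-id θ))))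
    (sym (lift-∷ θ (t ⟨ θ ⟩ₜ) idₛ))

  lift-✶ : ∀ {Γ Δ Θ σ} (θ : Sub 𝕊 Γ Δ) (ξ : Sub 𝕊 Δ Θ) →
    lift {σ = σ} θ ✶ lift ξ ≡ lift (θ ✶ ξ)
  lift-✶ θ ξ = cong (v₀ ∷_) (✶-square θ (wk-lift ξ))

  lift-id : ∀ {Γ σ} → lift {𝕊} {σ = σ} (idₛ {Γ = Γ}) ≡ idₛ
  lift-id = cong (v₀ ∷_) (id-✶ wkₛ)

  lifts : ∀ Ξ {Γ Δ} → Sub 𝕊 Γ Δ → Sub 𝕊 (Ξ ++ Γ) (Ξ ++ Δ)
  lifts []      θ = θ
  lifts (σ ∷ Ξ) θ = lift (lifts Ξ θ)

  lifts-✶ : ∀ Ξ {Γ Δ Θ} (θ : Sub 𝕊 Γ Δ) (ξ : Sub 𝕊 Δ Θ) →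
    lifts Ξ θ ✶ lifts Ξ ξ ≡ lifts Ξ (θ ✶ ξ)
  lifts-✶ []      θ ξ = refl
  lifts-✶ (σ ∷ Ξ) θ ξ = trans (lift-✶ (lifts Ξ θ) (lifts Ξ ξ)) (cong lift (lifts-✶ Ξ θ ξ))

  lifts-id : ∀ Ξ {Γ} → lifts Ξ (idₛ {Γ = Γ}) ≡ idₛ
  lifts-id []      = refl
  lifts-id (σ ∷ Ξ) = trans (cong lift (lifts-id Ξ)) lift-id

  wks-lifts : ∀ Ξ {Γ Δ} (θ : Sub 𝕊 Γ Δ) → wks Ξ ✶ lifts Ξ θ ≡ θ ✶ wks Ξ
  wks-lifts []      θ = trans (id-✶ θ) (sym (✶-id θ))
  wks-lifts (σ ∷ Ξ) θ =
    trans (cong (_✶ lift (lifts Ξ θ)) (sym (wks-✶-wkₛ Ξ)))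
      (trans (✶-square (wks Ξ) (wk-lift (lifts Ξ θ)))
        (trans (cong (_✶ wkₛ) (wks-lifts Ξ θ))
          (trans (✶-✶ θ _ _) (cong (θ ✶_) (wks-✶-wkₛ Ξ)))))

-- Substitution in formulas

module _ {L : Language} where

  ⟨⟩-✶ : ∀ {q Γ Δ Θ} (A : Fm L q Γ) (θ : Sub (sig L) Γ Δ) (ξ : Sub (sig L) Δ Θ) →
    A ⟨ θ ⟩ ⟨ ξ ⟩ ≡ A ⟨ θ ✶ ξ ⟩
  ⟨⟩-lift : ∀ {q Γ Δ Θ σ} (A : Fm L q (σ ∷ Γ)) (θ : Sub (sig L) Γ Δ) (ξ : Sub (sig L) Δ Θ) →
    A ⟨ lift θ ⟩ ⟨ lift ξ ⟩ ≡ A ⟨ lift (θ ✶ ξ) ⟩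

  ⟨⟩-✶ ⊥̇          θ ξ = refl
  ⟨⟩-✶ (t ≐ u)    θ ξ = cong₂ _≐_ (⟨⟩ₜ-✶ t θ ξ) (⟨⟩ₜ-✶ u θ ξ)
  ⟨⟩-✶ (rel R ts) θ ξ = cong (rel R) (✶-✶ ts θ ξ)
  ⟨⟩-✶ (A ∧̇ B)    θ ξ = cong₂ _∧̇_ (⟨⟩-✶ A θ ξ) (⟨⟩-✶ B θ ξ)
  ⟨⟩-✶ (A ⊃ B)    θ ξ = cong₂ _⊃_ (⟨⟩-✶ A θ ξ) (⟨⟩-✶ B θ ξ)
  ⟨⟩-✶ (∀̇ A)      θ ξ = cong ∀̇ (⟨⟩-lift A θ ξ)
  ⟨⟩-✶ (∃̇ A)      θ ξ = cong ∃̇ (⟨⟩-lift A θ ξ)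
  ⟨⟩-✶ (∀◁ B A)   θ ξ = cong₂ ∀◁ (⟨⟩-lift B θ ξ) (⟨⟩-lift A θ ξ)
  ⟨⟩-✶ (∃◁ B A)   θ ξ = cong₂ ∃◁ (⟨⟩-lift B θ ξ) (⟨⟩-lift A θ ξ)

  ⟨⟩-lift A θ ξ = trans (⟨⟩-✶ A (lift θ) (lift ξ)) (cong (A ⟨_⟩) (lift-✶ θ ξ))

  ⟨⟩-id : ∀ {q Γ} (A : Fm L q Γ) → A ⟨ idₛ ⟩ ≡ A
  ⟨⟩-lift-id : ∀ {q Γ σ} (A : Fm L q (σ ∷ Γ)) → A ⟨ lift idₛ ⟩ ≡ A

  ⟨⟩-id ⊥̇          = refl
  ⟨⟩-id (t ≐ u)    = cong₂ _≐_ (⟨⟩ₜ-id t) (⟨⟩ₜ-id u)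
  ⟨⟩-id (rel R ts) = cong (rel R) (✶-id ts)
  ⟨⟩-id (A ∧̇ B)    = cong₂ _∧̇_ (⟨⟩-id A) (⟨⟩-id B)
  ⟨⟩-id (A ⊃ B)    = cong₂ _⊃_ (⟨⟩-id A) (⟨⟩-id B)
  ⟨⟩-id (∀̇ A)      = cong ∀̇ (⟨⟩-lift-id A)
  ⟨⟩-id (∃̇ A)      = cong ∃̇ (⟨⟩-lift-id A)
  ⟨⟩-id (∀◁ B A)   = cong₂ ∀◁ (⟨⟩-lift-id B) (⟨⟩-lift-id A)
  ⟨⟩-id (∃◁ B A)   = cong₂ ∃◁ (⟨⟩-lift-id B) (⟨⟩-lift-id A)

  ⟨⟩-lift-id A = trans (cong (A ⟨_⟩) lift-id) (⟨⟩-id A)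

  ⟨⟩-square : ∀ {q Γ Δ Δ′ Θ} (A : Fm L q Γ)
    {θ : Sub (sig L) Γ Δ} {ξ : Sub (sig L) Δ Θ} {θ′ : Sub (sig L) Γ Δ′} {ξ′ : Sub (sig L) Δ′ Θ} →
    θ ✶ ξ ≡ θ′ ✶ ξ′ → A ⟨ θ ⟩ ⟨ ξ ⟩ ≡ A ⟨ θ′ ⟩ ⟨ ξ′ ⟩
  ⟨⟩-square A e = trans (⟨⟩-✶ A _ _) (trans (cong (A ⟨_⟩) e) (sym (⟨⟩-✶ A _ _)))

  ⟨⟩-retract : ∀ {q Γ Δ} (A : Fm L q Γ) {θ : Sub (sig L) Γ Δ} {ξ : Sub (sig L) Δ Γ} →
    θ ✶ ξ ≡ idₛ → A ⟨ θ ⟩ ⟨ ξ ⟩ ≡ A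
  ⟨⟩-retract A e = trans (⟨⟩-✶ A _ _) (trans (cong (A ⟨_⟩) e) (⟨⟩-id A))

  ⟨lift⟩-∷ : ∀ {q Γ Δ σ} (A : Fm L q (σ ∷ Γ)) (t : Tm (sig L) Δ σ) (θ : Sub (sig L) Γ Δ) →
    A ⟨ lift θ ⟩ ⟨ t ∷ idₛ ⟩ ≡ A ⟨ t ∷ θ ⟩
  ⟨lift⟩-∷ A t θ = trans (⟨⟩-✶ A _ _)
    (cong (A ⟨_⟩) (trans (lift-∷ θ t idₛ) (cong (t ∷_) (✶-id θ))))

-- Derivations

module _ {L : Language} {q : Quantifiers} {Ax : Fm L q [] → Set} where

  ⊢-≡ : ∀ {Γ} {Ψ : List (Fm L q Γ)} {A B} → A ≡ B → Ax ∣ Ψ ⊢ A → Ax ∣ Ψ ⊢ B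
  ⊢-≡ refl d = d

  ⊆-lift : ∀ {Γ Δ σ} {Ψ : List (Fm L q Γ)} {Ψ′ : List (Fm L q Δ)} {θ : Sub (sig L) Γ Δ} →
    (∀ {A} → A ∈ Ψ → A ⟨ θ ⟩ ∈ Ψ′) →
    ∀ {A : Fm L q (σ ∷ Γ)} → A ∈ map (_⟨ wkₛ ⟩) Ψ → A ⟨ lift θ ⟩ ∈ map (_⟨ wkₛ ⟩) Ψ′
  ⊆-lift {Ψ′ = Ψ′} {θ = θ} s i with ∈-map⁻ (_⟨ wkₛ ⟩) i
  ... | A , j , refl =
    subst (_∈ map (_⟨ wkₛ ⟩) Ψ′) (sym (⟨⟩-square A (wk-lift θ))) (∈-map⁺ (_⟨ wkₛ ⟩) (s j))

  ⊆-∷ : ∀ {Γ Δ} {Ψ : List (Fm L q Γ)} {Ψ′ : List (Fm L q Δ)} {θ : Sub (sig L) Γ Δ} {B} →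
    (∀ {A} → A ∈ Ψ → A ⟨ θ ⟩ ∈ Ψ′) → ∀ {A} → A ∈ (B ∷ Ψ) → A ⟨ θ ⟩ ∈ (B ⟨ θ ⟩ ∷ Ψ′)
  ⊆-∷ s (here refl) = here refl
  ⊆-∷ s (there i)   = there (s i)

  -- Hypotheses are related by an inclusion after substitution, so that one induction covers both
  -- instantiation of variables and weakening of hypotheses.
  ⊢-⟨⟩ : ∀ {Γ Δ} {Ψ : List (Fm L q Γ)} {Ψ′ : List (Fm L q Δ)} (θ : Sub (sig L) Γ Δ) →
    (∀ {A} → A ∈ Ψ → A ⟨ θ ⟩ ∈ Ψ′) → ∀ {A} → Ax ∣ Ψ ⊢ A → Ax ∣ Ψ′ ⊢ A ⟨ θ ⟩
  ⊢-⟨⟩ θ s (ax {A} a) = ⊢-≡ (sym (⟨⟩-✶ A [] θ)) (ax a)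
  ⊢-⟨⟩ θ s (hyp i)    = hyp (s i)
  ⊢-⟨⟩ θ s (⊥E d)     = ⊥E (⊢-⟨⟩ θ s d)
  ⊢-⟨⟩ θ s (∧I d e)   = ∧I (⊢-⟨⟩ θ s d) (⊢-⟨⟩ θ s e)
  ⊢-⟨⟩ θ s (∧E₁ d)    = ∧E₁ (⊢-⟨⟩ θ s d)
  ⊢-⟨⟩ θ s (∧E₂ d)    = ∧E₂ (⊢-⟨⟩ θ s d)
  ⊢-⟨⟩ θ s (⊃I d)     = ⊃I (⊢-⟨⟩ θ (⊆-∷ s) d)
  ⊢-⟨⟩ θ s (⊃E d e)   = ⊃E (⊢-⟨⟩ θ s d) (⊢-⟨⟩ θ s e)
  ⊢-⟨⟩ θ s (∀I d)     = ∀I (⊢-⟨⟩ (lift θ) (⊆-lift s) d)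
  ⊢-⟨⟩ θ s (∀E {A = A} d t) =
    ⊢-≡ (sym (⟨⟩-square A (∷-lift t θ))) (∀E (⊢-⟨⟩ θ s d) (t ⟨ θ ⟩ₜ))
  ⊢-⟨⟩ θ s (∃I {A = A} t d) =
    ∃I (t ⟨ θ ⟩ₜ) (⊢-≡ (⟨⟩-square A (∷-lift t θ)) (⊢-⟨⟩ θ s d))
  ⊢-⟨⟩ θ s (∃E {B = B} d e) =
    ∃E (⊢-⟨⟩ θ s d)
      (⊢-≡ (⟨⟩-square B (wk-lift θ)) (⊢-⟨⟩ (lift θ) (⊆-∷ (⊆-lift s)) e))
  ⊢-⟨⟩ θ s ≐I         = ≐I
  ⊢-⟨⟩ θ s (≐E A {t} {u} d e) =
    ⊢-≡ (sym (⟨⟩-square A (∷-lift u θ)))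
      (≐E (A ⟨ lift θ ⟩) (⊢-⟨⟩ θ s d)
        (⊢-≡ (⟨⟩-square A (∷-lift t θ)) (⊢-⟨⟩ θ s e)))

  weaken : ∀ {Γ} {Ψ : List (Fm L q Γ)} {A} → Ax ∣ [] ⊢ A → Ax ∣ Ψ ⊢ A
  weaken {A = A} d = ⊢-≡ (⟨⟩-id A) (⊢-⟨⟩ idₛ (λ ()) d)

  -- `closure` binds the head variable innermost; the recursive call instantiates the outer
  -- variables and leaves one quantifier to eliminate.
  closure-E : ∀ Γ {Δ} {Ψ : List (Fm L q Δ)} {A} → Ax ⊢ closure Γ A → (θ : Sub (sig L) Γ Δ) →
    Ax ∣ Ψ ⊢ A ⟨ θ ⟩
  closure-E []              d []      = ⊢-⟨⟩ [] (λ ()) d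
  closure-E (σ ∷ Γ) {A = A} d (t ∷ θ) =
    ⊢-≡ (⟨lift⟩-∷ A t θ) (∀E (closure-E Γ d θ) t)

  ∀⋆-I : ∀ Ξ {Γ} {A : Fm L q (Ξ ++ Γ)} → Ax ⊢ A → Ax ⊢ ∀⋆ Ξ A
  ∀⋆-I []      d = d
  ∀⋆-I (σ ∷ Ξ) d = ∀⋆-I Ξ (∀I d)

  module _ {Γ} {Ψ : List (Fm L q Γ)} where

    ≐-sym : ∀ {σ} {t u : Tm (sig L) Γ σ} → Ax ∣ Ψ ⊢ t ≐ u → Ax ∣ Ψ ⊢ u ≐ t
    ≐-sym {t = t} {u} d = subst (λ z → Ax ∣ Ψ ⊢ u ≐ z) (wkₜ-∷ t u)
      (≐E (v₀ ≐ t ⟨ wkₛ ⟩ₜ) d (subst (λ z → Ax ∣ Ψ ⊢ t ≐ z) (sym (wkₜ-∷ t t)) ≐I))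

    ≐-trans : ∀ {σ} {t u w : Tm (sig L) Γ σ} → Ax ∣ Ψ ⊢ t ≐ u → Ax ∣ Ψ ⊢ u ≐ w → Ax ∣ Ψ ⊢ t ≐ w
    ≐-trans {t = t} {u} {w} d e = subst (λ z → Ax ∣ Ψ ⊢ z ≐ w) (wkₜ-∷ t w)
      (≐E (t ⟨ wkₛ ⟩ₜ ≐ v₀) e (subst (λ z → Ax ∣ Ψ ⊢ z ≐ u) (sym (wkₜ-∷ t u)) d))

    ≐-·ˡ : ∀ {σ τ} {t u : Tm (sig L) Γ (σ ⇒ τ)} (w : Tm (sig L) Γ σ) →
      Ax ∣ Ψ ⊢ t ≐ u → Ax ∣ Ψ ⊢ t · w ≐ u · w
    ≐-·ˡ {t = t} {u} w d =
      subst₂ (λ y z → Ax ∣ Ψ ⊢ y · z ≐ u · z) (wkₜ-∷ t u) (wkₜ-∷ w u)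
        (≐E (t ⟨ wkₛ ⟩ₜ · w ⟨ wkₛ ⟩ₜ ≐ v₀ · w ⟨ wkₛ ⟩ₜ) d
          (subst (λ y → Ax ∣ Ψ ⊢ y · w ⟨ wkₛ ⟩ₜ ⟨ t ∷ idₛ ⟩ₜ ≐ t · w ⟨ wkₛ ⟩ₜ ⟨ t ∷ idₛ ⟩ₜ)
            (sym (wkₜ-∷ t t)) ≐I))

-- The guards `In` speak only of the bound variable, which `lift` fixes.
^𝓘-⟨⟩ : ∀ {L q Γ Δ} (A : Fm L q Γ) (θ : Sub (sig L) Γ Δ) → (A ⟨ θ ⟩) ^𝓘 ≡ (A ^𝓘) ⟨ θ ⟩
^𝓘-⟨⟩ ⊥̇          θ = refl
^𝓘-⟨⟩ (t ≐ u)    θ = refl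
^𝓘-⟨⟩ (rel R ts) θ = refl
^𝓘-⟨⟩ (A ∧̇ B)    θ = cong₂ _∧̇_ (^𝓘-⟨⟩ A θ) (^𝓘-⟨⟩ B θ)
^𝓘-⟨⟩ (A ⊃ B)    θ = cong₂ _⊃_ (^𝓘-⟨⟩ A θ) (^𝓘-⟨⟩ B θ)
^𝓘-⟨⟩ (∀̇ A)      θ = cong (λ A → ∀̇ (In v₀ ⊃ A)) (^𝓘-⟨⟩ A (lift θ))
^𝓘-⟨⟩ (∃̇ A)      θ = cong (λ A → ∃̇ (In v₀ ∧̇ A)) (^𝓘-⟨⟩ A (lift θ))
^𝓘-⟨⟩ (∀◁ B A)   θ = cong₂ (λ B A → ∀̇ (B ⊃ A)) (^𝓘-⟨⟩ B (lift θ)) (^𝓘-⟨⟩ A (lift θ))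
^𝓘-⟨⟩ (∃◁ B A)   θ = cong₂ (λ B A → ∃̇ (B ∧̇ A)) (^𝓘-⟨⟩ B (lift θ)) (^𝓘-⟨⟩ A (lift θ))

-- Witness tuples and environments under substitution

module _ {L : Language} (T : TargetTheory L) where
  open TargetTheory T

  private
    𝕊 : Signature
    𝕊 = sig target

  map⁺-✶ : ∀ {A : Set} {f : A → Type target} {xs Γ Δ} (ts : All (λ x → Tm 𝕊 Γ (f x)) xs)
    (θ : Sub 𝕊 Γ Δ) → map⁺ ts ✶ θ ≡ map⁺ {P = Tm 𝕊 Δ} (ts ✶ θ)
  map⁺-✶ []       θ = refl
  map⁺-✶ (t ∷ ts) θ = cong (_ ∷_) (map⁺-✶ ts θ)

  app-✶ : ∀ ρs {τ Γ Δ} (t : Tm 𝕊 Γ (type (arrow T ρs τ))) (us : Tms T Γ ρs) (θ : Sub 𝕊 Γ Δ) →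
    app T ρs {τ} t us ⟨ θ ⟩ₜ ≡ app T ρs {τ} (t ⟨ θ ⟩ₜ) (us ✶ θ)
  app-✶ []           t []       θ = refl
  app-✶ (ρ ∷ ρs) {τ} t (u ∷ us) θ = app-✶ ρs {τ} (t · u) us θ

  apply-✶ : ∀ ρs {τs Γ Δ} (ts : Tms T Γ (map (arrow T ρs) τs)) (us : Tms T Γ ρs)
    (θ : Sub 𝕊 Γ Δ) → apply T ρs {τs} ts us ✶ θ ≡ apply T ρs {τs} (ts ✶ θ) (us ✶ θ)
  apply-✶ ρs {[]}     []       us θ = refl
  apply-✶ ρs {τ ∷ τs} (t ∷ ts) us θ = cong₂ _∷_ (app-✶ ρs {τ} t us θ) (apply-✶ ρs {τs} ts us θ)

  vars-lifts : ∀ ρs {Γ Δ} (θ : Sub 𝕊 Γ Δ) → vars T ρs ✶ lifts (map type ρs) θ ≡ vars T ρs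
  vars-lifts []       θ = refl
  vars-lifts (ρ ∷ ρs) θ = cong (v₀ ∷_)
    (trans (✶-square (vars T ρs) (wk-lift (lifts (map type ρs) θ))) (cong (_✶ wkₛ) (vars-lifts ρs θ)))

  ∀∈-⟨⟩ : ∀ ρs {Γ Δ} (Bs : Tms T Γ (map _⋆ʷ ρs)) A (θ : Sub 𝕊 Γ Δ) →
    ∀∈ T ρs Bs A ⟨ θ ⟩ ≡ ∀∈ T ρs (Bs ✶ θ) (A ⟨ lifts (map type ρs) θ ⟩)
  ∀∈-⟨⟩ []       []       A θ = refl
  ∀∈-⟨⟩ (ρ ∷ ρs) (B ∷ Bs) A θ =
    trans (∀∈-⟨⟩ ρs Bs _ θ)
      (cong (λ C → ∀∈ T ρs (Bs ✶ θ) (∀̇ (mem ρ v₀ C ⊃ A ⟨ lifts (map type (ρ ∷ ρs)) θ ⟩)))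
        (⟨⟩ₜ-square B (wks-lifts (map type (ρ ∷ ρs)) θ)))

  instₛ : ∀ {ρs Δ} → Tms T Δ ρs → Sub 𝕊 (map type ρs ++ Δ) Δ
  instₛ us = ++⁺ (map⁺ us) idₛ

  vars-inst : ∀ {ρs Δ} (us : Tms T Δ ρs) → vars T ρs ✶ instₛ us ≡ us
  vars-inst []                = refl
  vars-inst {ρ ∷ ρs} (u ∷ us) = cong (u ∷_)
    (trans (✶-✶ (vars T ρs) _ _) (trans (cong (vars T ρs ✶_) (wkₛ-✶ u _)) (vars-inst us)))

  wks-inst : ∀ {ρs Δ} (us : Tms T Δ ρs) → wks (map type ρs) ✶ instₛ us ≡ idₛ
  wks-inst us = wks-++⁺ (map⁺ us) idₛ

  infixl 9 _⊙_

  -- Acts on the source side of an environment, whereas `✶` acts on its target side; `⊙-✶` says that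
  -- the two actions commute.
  _⊙_ : ∀ {Γ Γ′ Δ} → Sub (sig L) Γ Γ′ → Env T Γ′ Δ → Env T Γ Δ
  θ ⊙ η = All.map (λ t → ⟦_⟧ T t η) θ

  ⟦⟧-⟨⟩ : ∀ {Γ Γ′ Δ σ} (t : Tm (sig L) Γ σ) (θ : Sub (sig L) Γ Γ′) (η : Env T Γ′ Δ) →
    ⟦_⟧ T (t ⟨ θ ⟩ₜ) η ≡ ⟦_⟧ T t (θ ⊙ η)
  ⟦⟧-⟨⟩ (var x)  θ η = sym (lookup-map θ x)
  ⟦⟧-⟨⟩ (core c) θ η = refl
  ⟦⟧-⟨⟩ (con c)  θ η = refl
  ⟦⟧-⟨⟩ (t · u)  θ η = cong₂ _·_ (⟦⟧-⟨⟩ t θ η) (⟦⟧-⟨⟩ u θ η)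

  ⟦⟧-✶ : ∀ {Γ Δ Δ′ σ} (t : Tm (sig L) Γ σ) (η : Env T Γ Δ) (ξ : Sub 𝕊 Δ Δ′) →
    ⟦_⟧ T t η ⟨ ξ ⟩ₜ ≡ ⟦_⟧ T t (η ✶ ξ)
  ⟦⟧-✶ (var x)  η ξ = sym (lookup-map η x)
  ⟦⟧-✶ (core c) η ξ = refl
  ⟦⟧-✶ (con c)  η ξ = ⟨⟩ₜ-✶ (constant c) [] ξ
  ⟦⟧-✶ (t · u)  η ξ = cong₂ _·_ (⟦⟧-✶ t η ξ) (⟦⟧-✶ u η ξ)

  ⊙-✶ : ∀ {Γ Γ′ Δ Δ′} (θ : Sub (sig L) Γ Γ′) (η : Env T Γ′ Δ) (ξ : Sub 𝕊 Δ Δ′) →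
    (θ ⊙ η) ✶ ξ ≡ θ ⊙ (η ✶ ξ)
  ⊙-✶ []      η ξ = refl
  ⊙-✶ (t ∷ θ) η ξ = cong₂ _∷_ (⟦⟧-✶ t η ξ) (⊙-✶ θ η ξ)

  ✶-⊙ : ∀ {Γ Γ′ Γ″ Δ} (θ : Sub (sig L) Γ Γ′) (θ′ : Sub (sig L) Γ′ Γ″) (η : Env T Γ″ Δ) →
    (θ ✶ θ′) ⊙ η ≡ θ ⊙ (θ′ ⊙ η)
  ✶-⊙ []      θ′ η = refl
  ✶-⊙ (t ∷ θ) θ′ η = cong₂ _∷_ (⟦⟧-⟨⟩ t θ′ η) (✶-⊙ θ θ′ η)

  wkₛ-⊙ : ∀ σ {Γ Δ} (t : Tm 𝕊 Δ ⌜ σ ⌝) (η : Env T Γ Δ) → wkₛ ⊙ (_∷_ {x = σ} t η) ≡ η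
  wkₛ-⊙ σ t η = lookup-injective λ i →
    trans (lookup-map wkₛ i) (cong (λ u → ⟦_⟧ T u (_∷_ {x = σ} t η)) (lookup-tabulate (λ x → var (there x)) i))

  lift-⊙ : ∀ {Γ Γ′ Δ} σ (θ : Sub (sig L) Γ Γ′) (η : Env T Γ′ Δ) →
    lift θ ⊙ liftEnv T σ η ≡ liftEnv T σ (θ ⊙ η)
  lift-⊙ σ θ η = cong (v₀ ∷_)
    (trans (✶-⊙ θ wkₛ _) (trans (cong (θ ⊙_) (wkₛ-⊙ σ v₀ (η ✶ wkₛ))) (sym (⊙-✶ θ η wkₛ))))

  liftEnv-✶ : ∀ {Γ Δ Δ′} σ (η : Env T Γ Δ) (ξ : Sub 𝕊 Δ Δ′) →
    liftEnv T σ η ✶ lift ξ ≡ liftEnv T σ (η ✶ ξ)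
  liftEnv-✶ σ η ξ = cong (v₀ ∷_) (✶-square η (wk-lift ξ))

  -- Interpreted formulas

  Family : Cxt L → List Wit → List Wit → Set
  Family Γ p n = ∀ {Δ} → Env T Γ Δ → Tms T Δ p → Tms T Δ n → Fm target plain Δ

  record Interp (Γ : Cxt L) : Set where
    constructor interp
    field
      positive negative : List Wit
      formula           : Family Γ positive negative

  open Interp

  formula-cong : ∀ {Γ Δ} (I : Interp Γ) {η η′ : Env T Γ Δ} {a a′ b b′} →
    η ≡ η′ → a ≡ a′ → b ≡ b′ → formula I η a b ≡ formula I η′ a′ b′
  formula-cong I refl refl refl = refl

  -- A `Family` may be any function of its arguments, so compatibility with target substitution has
  -- to be carried as a property.
  Stable : ∀ {Γ} → Interp Γ → Set
  Stable I = ∀ {Δ Δ′} (θ : Sub 𝕊 Δ Δ′) η a b →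
    formula I η a b ⟨ θ ⟩ ≡ formula I (η ✶ θ) (a ✶ θ) (b ✶ θ)

  -- The operations `≐ᴵ`, `relᴵ`, `∧ᴵ`, `⊃ᴵ`, `∀ᴵ` and `∃ᴵ` repeat the clauses of `⟪_⟫`, so that
  -- `⌊_⌋` commutes with the connectives by definition.
  ≐ᴵ : ∀ {Γ σ} → Tm (sig L) Γ σ → Tm (sig L) Γ σ → Interp Γ
  ≐ᴵ t u = interp [] [] (λ η a b → ⟦_⟧ T t η ≐ ⟦_⟧ T u η)

  ≐-stable : ∀ {Γ σ} (t u : Tm (sig L) Γ σ) → Stable (≐ᴵ t u)
  ≐-stable t u θ η a b = cong₂ _≐_ (⟦⟧-✶ t η θ) (⟦⟧-✶ u η θ)

  relᴵ : ∀ {Γ σs} → AtomInterpretation T σs → Sub (sig L) σs Γ → Interp Γ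
  relᴵ α ts .positive = AtomInterpretation.pos α
  relᴵ α ts .negative = AtomInterpretation.neg α
  relᴵ α ts .formula η a b =
    AtomInterpretation.formula α ⟨ ++⁺ (map⁺ (All.map (λ t → ⟦_⟧ T t η) ts)) (++⁺ (map⁺ a) (map⁺ b)) ⟩

  rel-stable : ∀ {Γ σs} (α : AtomInterpretation T σs) (ts : Sub (sig L) σs Γ) → Stable (relᴵ α ts)
  rel-stable α ts θ η a b = trans (⟨⟩-✶ (AtomInterpretation.formula α) _ θ)
    (cong (AtomInterpretation.formula α ⟨_⟩)
      (trans (map-++⁺ (_⟨ θ ⟩ₜ) (map⁺ (ts ⊙ η)) (++⁺ (map⁺ a) (map⁺ b)))
        (cong₂ ++⁺ (trans (map⁺-✶ (ts ⊙ η) θ) (cong map⁺ (⊙-✶ ts η θ)))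
          (trans (map-++⁺ (_⟨ θ ⟩ₜ) (map⁺ a) (map⁺ b)) (cong₂ ++⁺ (map⁺-✶ a θ) (map⁺-✶ b θ))))))

  ∧ᴵ : ∀ {Γ} → Interp Γ → Interp Γ → Interp Γ
  ∧ᴵ I J .positive = positive I ++ positive J
  ∧ᴵ I J .negative = negative I ++ negative J
  ∧ᴵ I J .formula η a b =
    formula I η (++⁻ˡ (positive I) a) (++⁻ˡ (negative I) b)
      ∧̇ formula J η (++⁻ʳ (positive I) a) (++⁻ʳ (negative I) b)

  ∧-stable : ∀ {Γ} (I J : Interp Γ) → Stable I → Stable J → Stable (∧ᴵ I J)
  ∧-stable I J stI stJ θ η a b = cong₂ _∧̇_
    (trans (stI θ η _ _)
      (formula-cong I refl (map-++⁻ˡ (_⟨ θ ⟩ₜ) (positive I) a) (map-++⁻ˡ (_⟨ θ ⟩ₜ) (negative I) b)))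
    (trans (stJ θ η _ _)
      (formula-cong J refl (map-++⁻ʳ (_⟨ θ ⟩ₜ) (positive I) a) (map-++⁻ʳ (_⟨ θ ⟩ₜ) (negative I) b)))

  -- The matrix under `∀∈` in the clauses for implication and existence: the negative witnesses are
  -- fresh variables.
  generic : ∀ {Γ Δ} (I : Interp Γ) → Env T Γ Δ → Tms T Δ (positive I) →
    Fm target plain (map type (negative I) ++ Δ)
  generic I η a = formula I (wkEnv T Ξ η) (wkTms T Ξ a) (vars T (negative I))
    where
    Ξ = map type (negative I)

  generic-⟨⟩ : ∀ {Γ Δ Δ′} (I : Interp Γ) (stI : Stable I) (η : Env T Γ Δ) (a : Tms T Δ (positive I))
    (θ : Sub 𝕊 Δ Δ′) →
    generic I η a ⟨ lifts (map type (negative I)) θ ⟩ ≡ generic I (η ✶ θ) (a ✶ θ)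
  generic-⟨⟩ I stI η a θ = trans (stI _ _ _ _)
    (formula-cong I (✶-square η (wks-lifts Ξ θ)) (✶-square a (wks-lifts Ξ θ))
      (vars-lifts (negative I) θ))
    where
    Ξ = map type (negative I)

  ∀∈ᴵ : ∀ {Γ Δ} (I : Interp Γ) → Env T Γ Δ → Tms T Δ (positive I) → Tms T Δ (map _⋆ʷ (negative I)) →
    Fm target plain Δ
  ∀∈ᴵ I η a B = ∀∈ T (negative I) B (generic I η a)

  ∀∈ᴵ-cong : ∀ {Γ Δ} (I : Interp Γ) {η η′ : Env T Γ Δ} {a a′ B B′} →
    η ≡ η′ → a ≡ a′ → B ≡ B′ → ∀∈ᴵ I η a B ≡ ∀∈ᴵ I η′ a′ B′
  ∀∈ᴵ-cong I refl refl refl = refl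

  ∀∈ᴵ-⟨⟩ : ∀ {Γ Δ Δ′} (I : Interp Γ) (stI : Stable I) (η : Env T Γ Δ) a B (θ : Sub 𝕊 Δ Δ′) →
    ∀∈ᴵ I η a B ⟨ θ ⟩ ≡ ∀∈ᴵ I (η ✶ θ) (a ✶ θ) (B ✶ θ)
  ∀∈ᴵ-⟨⟩ I stI η a B θ =
    trans (∀∈-⟨⟩ (negative I) B _ θ) (cong (∀∈ T (negative I) (B ✶ θ)) (generic-⟨⟩ I stI η a θ))

  ⊃ᴵ : ∀ {Γ} → Interp Γ → Interp Γ → Interp Γ
  ⊃ᴵ I J .positive = map (arrow T (positive I)) (positive J)
                     ++ map (arrow T (positive I)) (map (arrow T (negative J)) (map _⋆ʷ (negative I)))
  ⊃ᴵ I J .negative = positive I ++ negative J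
  ⊃ᴵ I J .formula η fg ad = ∀∈ᴵ I η a gad ⊃ formula J η fa d
    where
    a   = ++⁻ˡ (positive I) ad
    d   = ++⁻ʳ (positive I) ad
    fs  = map (arrow T (positive I)) (positive J)
    fa  = apply T (positive I) (++⁻ˡ fs fg) a
    gad = apply T (negative J) (apply T (positive I) (++⁻ʳ fs fg) a) d

  ⊃-stable : ∀ {Γ} (I J : Interp Γ) → Stable I → Stable J → Stable (⊃ᴵ I J)
  ⊃-stable I J stI stJ θ η fg ad = cong₂ _⊃_
    (trans (∀∈ᴵ-⟨⟩ I stI η a _ θ)
      (∀∈ᴵ-cong I refl eqa
        (trans (apply-✶ (negative J) _ d θ)
          (cong₂ (apply T (negative J)) (trans (apply-✶ (positive I) (++⁻ʳ fs fg) a θ)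
            (cong₂ (apply T (positive I)) (map-++⁻ʳ (_⟨ θ ⟩ₜ) fs fg) eqa)) eqd))))
    (trans (stJ θ η _ _)
      (formula-cong J refl
        (trans (apply-✶ (positive I) (++⁻ˡ fs fg) a θ)
          (cong₂ (apply T (positive I)) (map-++⁻ˡ (_⟨ θ ⟩ₜ) fs fg) eqa)) eqd))
    where
    a   = ++⁻ˡ (positive I) ad
    d   = ++⁻ʳ (positive I) ad
    fs  = map (arrow T (positive I)) (positive J)
    eqa = map-++⁻ˡ (_⟨ θ ⟩ₜ) (positive I) ad
    eqd = map-++⁻ʳ (_⟨ θ ⟩ₜ) (positive I) ad

  ∀ᴵ : ∀ {Γ σ} → Interp (σ ∷ Γ) → Interp Γ
  ∀ᴵ I .positive = positive I
  ∀ᴵ I .negative = negative I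
  ∀ᴵ {σ = σ} I .formula η a b =
    ∀̇ (formula I (liftEnv T σ η) (wkTms T (⌜ σ ⌝ ∷ []) a) (wkTms T (⌜ σ ⌝ ∷ []) b))

  ∀-stable : ∀ {Γ σ} (I : Interp (σ ∷ Γ)) → Stable I → Stable (∀ᴵ I)
  ∀-stable {σ = σ} I stI θ η a b = cong ∀̇
    (trans (stI _ _ _ _)
      (formula-cong I (liftEnv-✶ σ η θ) (✶-square a (wk-lift θ)) (✶-square b (wk-lift θ))))

  ∃ᴵ : ∀ {Γ σ} → Interp (σ ∷ Γ) → Interp Γ
  ∃ᴵ I .positive = positive I
  ∃ᴵ I .negative = map _⋆ʷ (negative I)
  ∃ᴵ {σ = σ} I .formula η a b =
    ∃̇ (∀∈ᴵ I (liftEnv T σ η) (wkTms T (⌜ σ ⌝ ∷ []) a) (wkTms T (⌜ σ ⌝ ∷ []) b))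

  ∃-stable : ∀ {Γ σ} (I : Interp (σ ∷ Γ)) → Stable I → Stable (∃ᴵ I)
  ∃-stable {σ = σ} I stI θ η a b = cong ∃̇
    (trans (∀∈ᴵ-⟨⟩ I stI (liftEnv T σ η) (a ✶ wkₛ) (b ✶ wkₛ) (lift θ))
      (∀∈ᴵ-cong I (liftEnv-✶ σ η θ) (✶-square a (wk-lift θ)) (✶-square b (wk-lift θ))))

  -- Stands for the substituted formula: only the environment is changed, so the witness types stay
  -- the same by definition.
  reindex : ∀ {Γ Γ′} → Sub (sig L) Γ Γ′ → Interp Γ → Interp Γ′
  reindex θ I = interp (positive I) (negative I) (λ η → formula I (θ ⊙ η))

  reindex-stable : ∀ {Γ Γ′} (θ : Sub (sig L) Γ Γ′) (I : Interp Γ) →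
    Stable I → Stable (reindex θ I)
  reindex-stable θ I stI ξ η a b =
    trans (stI ξ (θ ⊙ η) a b) (formula-cong I (⊙-✶ θ η ξ) refl refl)

  -- Matching on same identifies the witness types of both sides, which are
  -- only propositionally equal for the instances A ⟨ θ ⟩ of a formula A.

  infix 4 _≈_

  data _≈_ {Γ} : Interp Γ → Interp Γ → Set where
    same : ∀ {p n} {F F′ : Family Γ p n} →
           (∀ {Δ} (η : Env T Γ Δ) a b → F η a b ≡ F′ η a b) → interp p n F ≈ interp p n F′

  ≈-trans : ∀ {Γ} {I J K : Interp Γ} → I ≈ J → J ≈ K → I ≈ K
  ≈-trans (same h) (same k) = same λ η a b → trans (h η a b) (k η a b)

  ≈-refl : ∀ {Γ} (I : Interp Γ) → I ≈ I
  ≈-refl I = same λ η a b → refl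

  positive-≈ : ∀ {Γ} {I J : Interp Γ} → I ≈ J → positive I ≡ positive J
  positive-≈ (same _) = refl

  ∧-≈ : ∀ {Γ} {I I′ J J′ : Interp Γ} → I ≈ I′ → J ≈ J′ → ∧ᴵ I J ≈ ∧ᴵ I′ J′
  ∧-≈ (same h) (same k) = same λ η a b → cong₂ _∧̇_ (h _ _ _) (k _ _ _)

  ⊃-≈ : ∀ {Γ} {I I′ J J′ : Interp Γ} → I ≈ I′ → J ≈ J′ → ⊃ᴵ I J ≈ ⊃ᴵ I′ J′
  ⊃-≈ (same {n = n} h) (same k) =
    same λ η a b → cong₂ _⊃_ (cong (∀∈ T n _) (h _ _ _)) (k _ _ _)

  ∀-≈ : ∀ {Γ σ} {I I′ : Interp (σ ∷ Γ)} → I ≈ I′ → ∀ᴵ I ≈ ∀ᴵ I′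
  ∀-≈ (same h) = same λ η a b → cong ∀̇ (h _ _ _)

  ∃-≈ : ∀ {Γ σ} {I I′ : Interp (σ ∷ Γ)} → I ≈ I′ → ∃ᴵ I ≈ ∃ᴵ I′
  ∃-≈ (same {n = n} h) = same λ η a b → cong (λ A → ∃̇ (∀∈ T n (b ✶ wkₛ) A)) (h _ _ _)

  ∀∈ᴵ-reindex : ∀ {Γ Γ′ Δ} (θ : Sub (sig L) Γ Γ′) (I : Interp Γ) (η : Env T Γ′ Δ) a B →
    ∀∈ᴵ (reindex θ I) η a B ≡ ∀∈ᴵ I (θ ⊙ η) a B
  ∀∈ᴵ-reindex θ I η a B =
    cong (∀∈ T (negative I) B) (formula-cong I (sym (⊙-✶ θ η _)) refl refl)

  ⊃-reindex : ∀ {Γ Γ′} (θ : Sub (sig L) Γ Γ′) (I J : Interp Γ) →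
    ⊃ᴵ (reindex θ I) (reindex θ J) ≈ reindex θ (⊃ᴵ I J)
  ⊃-reindex θ I J = same λ η a b → cong₂ _⊃_ (∀∈ᴵ-reindex θ I η _ _) refl

  ∀-reindex : ∀ {Γ Γ′ σ} (θ : Sub (sig L) Γ Γ′) (I : Interp (σ ∷ Γ)) →
    ∀ᴵ (reindex (lift θ) I) ≈ reindex θ (∀ᴵ I)
  ∀-reindex {σ = σ} θ I = same λ η a b → cong ∀̇ (formula-cong I (lift-⊙ σ θ η) refl refl)

  ∃-reindex : ∀ {Γ Γ′ σ} (θ : Sub (sig L) Γ Γ′) (I : Interp (σ ∷ Γ)) →
    ∃ᴵ (reindex (lift θ) I) ≈ reindex θ (∃ᴵ I)
  ∃-reindex {σ = σ} θ I = same λ η a b → cong ∃̇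
    (trans (∀∈ᴵ-reindex (lift θ) I (liftEnv T σ η) (a ✶ wkₛ) (b ✶ wkₛ))
      (∀∈ᴵ-cong I (lift-⊙ σ θ η) refl refl))

  -- Provable equality of tuples

  data EqualTms {Δ} (Ψ : List (Fm target plain Δ)) : ∀ {ρs} (ts us : Tms T Δ ρs) → Set where
    []  : EqualTms Ψ [] []
    _∷_ : ∀ {ρ ρs} {t u : Tm 𝕊 Δ (type ρ)} {ts us : Tms T Δ ρs} →
          Axiom ∣ Ψ ⊢ t ≐ u → EqualTms Ψ ts us → EqualTms Ψ {ρ ∷ ρs} (t ∷ ts) (u ∷ us)

  module _ {Δ} {Ψ : List (Fm target plain Δ)} where

    EqualTms-≡ : ∀ {ρs} {ts us : Tms T Δ ρs} → ts ≡ us → EqualTms Ψ ts us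
    EqualTms-≡ {ts = []}    refl = []
    EqualTms-≡ {ts = _ ∷ _} refl = ≐I ∷ EqualTms-≡ refl

    EqualTms-sym : ∀ {ρs} {ts us : Tms T Δ ρs} → EqualTms Ψ ts us → EqualTms Ψ us ts
    EqualTms-sym []       = []
    EqualTms-sym (d ∷ ds) = ≐-sym d ∷ EqualTms-sym ds

    EqualTms-trans : ∀ {ρs} {ts us ws : Tms T Δ ρs} →
      EqualTms Ψ ts us → EqualTms Ψ us ws → EqualTms Ψ ts ws
    EqualTms-trans []       []       = []
    EqualTms-trans (d ∷ ds) (e ∷ es) = ≐-trans d e ∷ EqualTms-trans ds es

    -- `≐E` replaces the head while the tail is held at `us`. The new head is then substituted into
    -- `A`, weakened past the tail variables, and the recursion replaces the tail.
    replace : ∀ {ρs} {us us′ : Tms T Δ ρs} → EqualTms Ψ us us′ →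
      (A : Fm target plain (map type ρs ++ Δ)) →
      Axiom ∣ Ψ ⊢ A ⟨ instₛ us ⟩ → Axiom ∣ Ψ ⊢ A ⟨ instₛ us′ ⟩
    replace []                                                A d = d
    replace (_∷_ {ρs = ρs} {u} {u′} {us} {us′} e es) A d =
      ⊢-≡ (instTail us′)
        (replace es (A ⟨ u′ ⟨ wks (map type ρs) ⟩ₜ ∷ idₛ ⟩)
          (⊢-≡ (trans (⟨lift⟩-∷ A u′ (instₛ us)) (sym (instTail us)))
            (≐E (A ⟨ lift (instₛ us) ⟩) e
              (⊢-≡ (sym (⟨lift⟩-∷ A u (instₛ us))) d))))
      where
      instTail : (ws : Tms T Δ ρs) →
        A ⟨ u′ ⟨ wks (map type ρs) ⟩ₜ ∷ idₛ ⟩ ⟨ instₛ ws ⟩ ≡ A ⟨ u′ ∷ instₛ ws ⟩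
      instTail ws = trans (⟨⟩-✶ A _ _) (cong (A ⟨_⟩) (cong₂ _∷_
        (trans (⟨⟩ₜ-✶ u′ _ _) (trans (cong (u′ ⟨_⟩ₜ) (wks-inst ws)) (⟨⟩ₜ-id u′)))
        (id-✶ (instₛ ws))))

    -- Stability exhibits both formulas as instances of one formula whose positive witnesses are
    -- variables, and `replace` applies to that formula.
    formula-replace : ∀ {Γ} (I : Interp Γ) (stI : Stable I) (η : Env T Γ Δ) {a a′} b →
      EqualTms Ψ a a′ →
      Axiom ∣ Ψ ⊢ formula I η a b → Axiom ∣ Ψ ⊢ formula I η a′ b
    formula-replace I stI η {a} {a′} b e d =
      ⊢-≡ (inst a′) (replace e A (⊢-≡ (sym (inst a)) d))
      where
      Ξ = map type (positive I)
      A = formula I (wkEnv T Ξ η) (vars T (positive I)) (wkTms T Ξ b)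

      inst : ∀ a → A ⟨ instₛ a ⟩ ≡ formula I η a b
      inst a = trans (stI (instₛ a) _ _ _)
        (formula-cong I (✶-retract η (wks-inst a)) (vars-inst a) (✶-retract b (wks-inst a)))

    ∀∈-replace : ∀ ρs {Bs Bs′ : Tms T Δ (map _⋆ʷ ρs)} (A : Fm target plain (map type ρs ++ Δ)) →
      EqualTms Ψ Bs Bs′ → Axiom ∣ Ψ ⊢ ∀∈ T ρs Bs A → Axiom ∣ Ψ ⊢ ∀∈ T ρs Bs′ A
    ∀∈-replace ρs {Bs} {Bs′} A e d =
      ⊢-≡ (inst Bs′) (replace e A⁺ (⊢-≡ (sym (inst Bs)) d))
      where
      Ξ  = map type ρs
      Ξ⋆ = map type (map _⋆ʷ ρs)
      -- The bounding sets become variables; the matrix is weakened past them, underneath the block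
      -- `Ξ` of its own bound variables.
      A⁺ = ∀∈ T ρs (vars T (map _⋆ʷ ρs)) (A ⟨ lifts Ξ (wks Ξ⋆) ⟩)

      inst : ∀ Bs → A⁺ ⟨ instₛ Bs ⟩ ≡ ∀∈ T ρs Bs A
      inst Bs = trans (∀∈-⟨⟩ ρs _ _ (instₛ Bs))
        (cong₂ (∀∈ T ρs) (vars-inst Bs)
          (⟨⟩-retract A (trans (lifts-✶ Ξ _ _)
            (trans (cong (lifts Ξ) (wks-inst Bs)) (lifts-id Ξ)))))

  -- Constant functions and projections

  constant-fun : ∀ ρs τ {Δ} → Tm 𝕊 Δ (type τ) → Tm 𝕊 Δ (type (arrow T ρs τ))
  constant-fun []       τ t = t
  constant-fun (ρ ∷ ρs) τ t = core 𝐊 · constant-fun ρs τ t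

  constant-funs : ∀ ρs {τs Δ} → Tms T Δ τs → Tms T Δ (map (arrow T ρs) τs)
  constant-funs ρs          []       = []
  constant-funs ρs {τ ∷ τs} (t ∷ ts) = constant-fun ρs τ t ∷ constant-funs ρs ts

  constant-fun-⟨⟩ : ∀ ρs τ {Γ Δ} (t : Tm 𝕊 Γ (type τ)) (θ : Sub 𝕊 Γ Δ) →
    constant-fun ρs τ t ⟨ θ ⟩ₜ ≡ constant-fun ρs τ (t ⟨ θ ⟩ₜ)
  constant-fun-⟨⟩ []       τ t θ = refl
  constant-fun-⟨⟩ (ρ ∷ ρs) τ t θ = cong (core 𝐊 ·_) (constant-fun-⟨⟩ ρs τ t θ)

  constant-funs-✶ : ∀ ρs {τs Γ Δ} (ts : Tms T Γ τs) (θ : Sub 𝕊 Γ Δ) →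
    constant-funs ρs ts ✶ θ ≡ constant-funs ρs (ts ✶ θ)
  constant-funs-✶ ρs          []       θ = refl
  constant-funs-✶ ρs {τ ∷ τs} (t ∷ ts) θ =
    cong₂ _∷_ (constant-fun-⟨⟩ ρs τ t θ) (constant-funs-✶ ρs ts θ)

  prepend : ∀ ρ ρs {τs Δ} → Tms T Δ (map (arrow T ρs) τs) → Tms T Δ (map (arrow T (ρ ∷ ρs)) τs)
  prepend ρ ρs {[]}     []       = []
  prepend ρ ρs {τ ∷ τs} (t ∷ ts) = core 𝐊 · t ∷ prepend ρ ρs {τs} ts

  prepend-✶ : ∀ ρ ρs {τs Γ Δ} (ts : Tms T Γ (map (arrow T ρs) τs)) (θ : Sub 𝕊 Γ Δ) →
    prepend ρ ρs {τs} ts ✶ θ ≡ prepend ρ ρs {τs} (ts ✶ θ)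
  prepend-✶ ρ ρs {[]}     []       θ = refl
  prepend-✶ ρ ρs {τ ∷ τs} (t ∷ ts) θ = cong (_ ∷_) (prepend-✶ ρ ρs {τs} ts θ)

  -- `𝐒 𝐊 𝐊` is the identity, and `𝐒 (𝐊 𝐊) p` sends `u` to `𝐊 (p u)`, which discards the argument of
  -- type `ρ′` and continues as `p u`.
  first-projection : ∀ ρ ρs {Δ} → Tm 𝕊 Δ (type ρ ⇒ type (arrow T ρs ρ))
  first-projection ρ []        = core 𝐒 · core 𝐊 · core (𝐊 {τ = type ρ})
  first-projection ρ (ρ′ ∷ ρs) = core 𝐒 · (core 𝐊 · core 𝐊) · first-projection ρ ρs

  projections : ∀ ρs {Δ} → Tms T Δ (map (arrow T ρs) ρs)
  projections []       = []
  projections (ρ ∷ ρs) = first-projection ρ ρs ∷ prepend ρ ρs {ρs} (projections ρs)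

  first-projection-⟨⟩ : ∀ ρ ρs {Γ Δ} (θ : Sub 𝕊 Γ Δ) →
    first-projection ρ ρs ⟨ θ ⟩ₜ ≡ first-projection ρ ρs
  first-projection-⟨⟩ ρ []        θ = refl
  first-projection-⟨⟩ ρ (ρ′ ∷ ρs) θ = cong (_ ·_) (first-projection-⟨⟩ ρ ρs θ)

  projections-✶ : ∀ ρs {Γ Δ} (θ : Sub 𝕊 Γ Δ) → projections ρs ✶ θ ≡ projections ρs
  projections-✶ []       θ = refl
  projections-✶ (ρ ∷ ρs) θ = cong₂ _∷_ (first-projection-⟨⟩ ρ ρs θ)
    (trans (prepend-✶ ρ ρs {ρs} (projections ρs) θ) (cong (prepend ρ ρs {ρs}) (projections-✶ ρs θ)))

  module _ {Δ} {Ψ : List (Fm target plain Δ)} where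

    𝐊-≐ : ∀ {σ τ} (t : Tm 𝕊 Δ σ) (u : Tm 𝕊 Δ τ) → Axiom ∣ Ψ ⊢ core 𝐊 · t · u ≐ t
    𝐊-≐ {σ} {τ} t u = closure-E (τ ∷ σ ∷ []) (proves-HAω 𝐊-eq) (u ∷ t ∷ [])

    𝐒-≐ : ∀ {ρ σ τ} (t : Tm 𝕊 Δ (ρ ⇒ σ ⇒ τ)) (u : Tm 𝕊 Δ (ρ ⇒ σ)) (w : Tm 𝕊 Δ ρ) →
      Axiom ∣ Ψ ⊢ core 𝐒 · t · u · w ≐ t · w · (u · w)
    𝐒-≐ {ρ} {σ} {τ} t u w =
      closure-E (ρ ∷ (ρ ⇒ σ) ∷ (ρ ⇒ σ ⇒ τ) ∷ []) (proves-HAω 𝐒-eq) (w ∷ u ∷ t ∷ [])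

    app-cong : ∀ ρs τ {t t′ : Tm 𝕊 Δ (type (arrow T ρs τ))} (us : Tms T Δ ρs) →
      Axiom ∣ Ψ ⊢ t ≐ t′ → Axiom ∣ Ψ ⊢ app T ρs {τ} t us ≐ app T ρs {τ} t′ us
    app-cong []       τ []       d = d
    app-cong (ρ ∷ ρs) τ (u ∷ us) d = app-cong ρs τ us (≐-·ˡ u d)

    apply-cong : ∀ ρs {τs} {ts ts′ : Tms T Δ (map (arrow T ρs) τs)} (us : Tms T Δ ρs) →
      EqualTms Ψ ts ts′ → EqualTms Ψ (apply T ρs {τs} ts us) (apply T ρs {τs} ts′ us)
    apply-cong ρs {[]}     us []       = []
    apply-cong ρs {τ ∷ τs} us (d ∷ ds) = app-cong ρs τ us d ∷ apply-cong ρs {τs} us ds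

    apply-constant-funs : ∀ ρs {τs} (ts : Tms T Δ τs) (us : Tms T Δ ρs) →
      EqualTms Ψ (apply T ρs {τs} (constant-funs ρs ts) us) ts
    apply-constant-funs ρs          []       us = []
    apply-constant-funs ρs {τ ∷ τs} (t ∷ ts) us = app-constant-fun ρs us ∷ apply-constant-funs ρs ts us
      where
      app-constant-fun : ∀ ρs us → Axiom ∣ Ψ ⊢ app T ρs {τ} (constant-fun ρs τ t) us ≐ t
      app-constant-fun []       []       = ≐I
      app-constant-fun (ρ ∷ ρs) (u ∷ us) =
        ≐-trans (app-cong ρs τ us (𝐊-≐ (constant-fun ρs τ t) u)) (app-constant-fun ρs us)

    app-first-projection : ∀ ρ ρs (u : Tm 𝕊 Δ (type ρ)) (us : Tms T Δ ρs) →
      Axiom ∣ Ψ ⊢ app T ρs {ρ} (first-projection ρ ρs · u) us ≐ u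
    app-first-projection ρ []        u []       =
      ≐-trans (𝐒-≐ (core 𝐊) (core 𝐊) u) (𝐊-≐ u (core 𝐊 · u))
    app-first-projection ρ (ρ′ ∷ ρs) u (w ∷ us) =
      ≐-trans (app-cong ρs ρ us
        (≐-trans (≐-·ˡ w (≐-trans (𝐒-≐ (core 𝐊 · core 𝐊) (first-projection ρ ρs) u)
                                  (≐-·ˡ (first-projection ρ ρs · u) (𝐊-≐ (core 𝐊) u))))
          (𝐊-≐ (first-projection ρ ρs · u) w)))
        (app-first-projection ρ ρs u us)

    apply-prepend : ∀ ρ ρs {τs} (ts : Tms T Δ (map (arrow T ρs) τs)) (u : Tm 𝕊 Δ (type ρ)) us →
      EqualTms Ψ (apply T (ρ ∷ ρs) {τs} (prepend ρ ρs {τs} ts) (u ∷ us)) (apply T ρs {τs} ts us)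
    apply-prepend ρ ρs {[]}     []       u us = []
    apply-prepend ρ ρs {τ ∷ τs} (t ∷ ts) u us =
      app-cong ρs τ us (𝐊-≐ t u) ∷ apply-prepend ρ ρs {τs} ts u us

    apply-projections : ∀ ρs (us : Tms T Δ ρs) →
      EqualTms Ψ (apply T ρs {ρs} (projections ρs) us) us
    apply-projections []       []       = []
    apply-projections (ρ ∷ ρs) (u ∷ us) = app-first-projection ρ ρs u us ∷
      EqualTms-trans (apply-prepend ρ ρs {ρs} (projections ρs) u us) (apply-projections ρs us)

    -- max {t} lies in {t} and hence equals t, so that maximum-bound yields t ≤ t
    -- without an induction on t ∸ t.

    ≤̇-refl : (t : Tm 𝕊 Δ nat) → Axiom ∣ Ψ ⊢ t ≤̇ t
    ≤̇-refl t = subst (λ u → Axiom ∣ Ψ ⊢ u ≤̇ t) (wkₜ-∷ t t)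
      (≐E (t ⟨ wkₛ ⟩ₜ ≤̇ v₀) max≐t
        (subst (λ u → Axiom ∣ Ψ ⊢ u ≤̇ m) (sym (wkₜ-∷ t m)) t≤max))
      where
      s = con (singleton natʷ) · t
      m = con maximum · s

      ∈s : (u : Tm 𝕊 Δ nat) → Axiom ∣ Ψ ⊢ mem natʷ u s ⇔̇ u ≐ t
      ∈s u = closure-E (nat ∷ nat ∷ []) (proves-⋆ (mem-singleton natʷ)) (t ∷ u ∷ [])

      max≐t : Axiom ∣ Ψ ⊢ m ≐ t
      max≐t = ⊃E (∧E₁ (∈s m)) (closure-E (nat ⋆ ∷ []) (proves-⋆ maximum-mem) (s ∷ []))

      t≤max : Axiom ∣ Ψ ⊢ t ≤̇ m
      t≤max = ⊃E (closure-E (nat ∷ nat ⋆ ∷ []) (proves-⋆ maximum-bound) (t ∷ s ∷ []))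
        (⊃E (∧E₂ (∈s t)) ≐I)

  ∀∈-mono : ∀ ρs {Δ} (Bs : Tms T Δ (map _⋆ʷ ρs)) {A A′ : Fm target plain (map type ρs ++ Δ)} →
    Axiom ⊢ A ⊃ A′ → Axiom ⊢ ∀∈ T ρs Bs A ⊃ ∀∈ T ρs Bs A′
  ∀∈-mono []       []       d = d
  ∀∈-mono (ρ ∷ ρs) (B ∷ Bs) {A} {A′} d = ∀∈-mono ρs Bs
    (⊃I (∀I (⊃I (⊃E (weaken d) (⊃E
      -- Weakening the bounded quantifier past the new variable and instantiating it at that
      -- variable gives back its own body.
      (⊢-≡ (⟨⟩-retract M (trans (lift-∷ wkₛ v₀ idₛ) eq))
        (∀E {A = M ⟨ lift wkₛ ⟩} (hyp (there (here refl))) v₀))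
      (hyp (here refl)))))))
    where
    M = mem ρ v₀ (B ⟨ wks (type ρ ∷ map type ρs) ⟩ₜ) ⊃ A

    eq : v₀ ∷ wkₛ ✶ idₛ ≡ idₛ {𝕊}
    eq = cong (v₀ ∷_) (✶-id wkₛ)

  -- The instance is expressed by extending the environment with `t`, which is the form that
  -- `premise≡bounded` compares with the premise.
  ∃ᴵ-I : ∀ {Γ σ Δ Ψ} (I : Interp (σ ∷ Γ)) (stI : Stable I) (η : Env T Γ Δ) a b (t : Tm 𝕊 Δ ⌜ σ ⌝) →
    Axiom ∣ Ψ ⊢ ∀∈ᴵ I (t ∷ η) a b → Axiom ∣ Ψ ⊢ formula (∃ᴵ I) η a b
  ∃ᴵ-I {σ = σ} I stI η a b t d = ∃I t (⊢-≡ (sym eq) d)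
    where
    retract = wkₛ-✶ t idₛ

    eq : ∀∈ᴵ I (liftEnv T σ η) (a ✶ wkₛ) (b ✶ wkₛ) ⟨ t ∷ idₛ ⟩ ≡ ∀∈ᴵ I (t ∷ η) a b
    eq = trans (∀∈ᴵ-⟨⟩ I stI (liftEnv T σ η) (a ✶ wkₛ) (b ✶ wkₛ) (t ∷ idₛ))
      (∀∈ᴵ-cong I (cong (t ∷_) (✶-retract η retract)) (✶-retract a retract) (✶-retract b retract))

  -- Closed realizers

  Realizes : ∀ {Γ} (I : Interp Γ) → Tms T [] (positive I) → Set
  Realizes {Γ} I t = ∀ {Δ} (η : Env T Γ Δ) b → Axiom ⊢ formula I η (t ✶ []) b

  Realizable : ∀ {Γ} → Interp Γ → Set
  Realizable I = Σ[ t ∈ Tms T [] (positive I) ] Realizes I t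

  Realizable-≈ : ∀ {Γ} {I J : Interp Γ} → _≈_ I J → Realizable J → Realizable I
  Realizable-≈ (same h) (t , r) = t , λ η b → ⊢-≡ (sym (h η _ b)) (r η b)

  -- Realizers work in every environment, in particular in the lifted one, so the same closed tuple
  -- serves under the quantifier.
  Realizable-∀ : ∀ {Γ σ} (I : Interp (σ ∷ Γ)) → Realizable I → Realizable (∀ᴵ I)
  Realizable-∀ {σ = σ} I (t , r) = t , λ η b →
    ∀I (subst (λ a → Axiom ⊢ formula I (liftEnv T σ η) a (b ✶ wkₛ)) (sym (✶-✶ t [] wkₛ))
      (r (liftEnv T σ η) (b ✶ wkₛ)))

  -- Constant functions with values in the realizer of `J` serve for the implication. This is how
  -- the guards in `closure𝓘` are put in front of the principle.
  Realizable-⊃ : ∀ {Γ} (I J : Interp Γ) → Stable J → Realizable J → Realizable (⊃ᴵ I J)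
  Realizable-⊃ I J stJ (t , r) = ++⁺ f g , λ η ad →
    let a = ++⁻ˡ (positive I) ad
        d = ++⁻ʳ (positive I) ad
    in ⊃I (formula-replace J stJ η d
         (EqualTms-sym (EqualTms-trans
           (apply-cong (positive I) {positive J} a (EqualTms-≡ fs-✶))
           (apply-constant-funs (positive I) (t ✶ []) a)))
         (weaken (r η d)))
    where
    fs = map (arrow T (positive I)) (positive J)

    f : Tms T [] fs
    f = constant-funs (positive I) t

    g : Tms T [] (map (arrow T (positive I)) (map (arrow T (negative J)) (map _⋆ʷ (negative I))))
    -- Since `J` is realized outright, arbitrary sets of negative witnesses for `I` will do.
    g = All.tabulate λ {ρ} _ → inhabitant ρ

    fs-✶ : ∀ {Δ} → ++⁻ˡ fs (++⁺ f g ✶ []) ≡ constant-funs (positive I) (_✶_ {Δ = Δ} t [])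
    fs-✶ = trans (cong (++⁻ˡ fs) (map-++⁺ (_⟨ [] ⟩ₜ) f g))
      (trans (++⁻ˡ-++⁺ (f ✶ []) (g ✶ [])) (constant-funs-✶ (positive I) t []))

  -- The principle at the level of interpretations

  module _ {Γ : Cxt L} {σ : Type L} (α : AtomInterpretation T (nat ∷ []))
           (B : Interp (σ ∷ Γ)) (C : Interp (nat ∷ σ ∷ Γ)) where

    premiseᴵ : Interp Γ
    premiseᴵ = ∀ᴵ (⊃ᴵ B (∃ᴵ (∧ᴵ (relᴵ α (v₀ ∷ [])) C)))

    -- Under relativization the restricting formula `n ≤ k` takes the place of the guard on `n`. In
    -- the premise that guard is the bounding atom, which reads `n ≤ m`; this is why the two
    -- matrices can coincide.
    matrixᴵ : Interp (nat ∷ σ ∷ nat ∷ Γ)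
    matrixᴵ = ∧ᴵ (≐ᴵ (v₀ ∸̇ v₂) (core O)) (reindex (lift (lift wkₛ)) C)

    boundedᴵ : Interp (nat ∷ Γ)
    boundedᴵ = ∀ᴵ (⊃ᴵ (reindex (lift wkₛ) B) (∃ᴵ matrixᴵ))

    conclusionᴵ : Interp Γ
    conclusionᴵ = ∃ᴵ (∧ᴵ (relᴵ α (v₀ ∷ [])) boundedᴵ)

  module _ {Γ : Cxt L} {σ : Type L} {n : List Wit}
           (F : Family (σ ∷ Γ) [] n) (C : Interp (nat ∷ σ ∷ Γ))
           (stB : Stable (interp [] n F)) (stC : Stable C) where

    private
      B = interp [] n F
      P = premiseᴵ (bounding T) B C
      R = boundedᴵ (bounding T) B C
      I = relᴵ {Γ = nat ∷ Γ} (bounding T) (v₀ ∷ [])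
      K = ∧ᴵ I R
      Q = conclusionᴵ (bounding T) B C

    -- With no positive witnesses in `B`, the arrows over them are trivial: the first positive
    -- witness of `P` is a number `k`, and the remaining ones are exactly those of `R`. The formulas
    -- then differ only in their environments, where the extra entry `k` on the right is skipped by
    -- `wkₛ` in `B` and `C`. The two bounds on `n` agree by `refl`, as the core constants are
    -- interpreted by themselves.
    premise≡bounded : ∀ {Δ} (η : Env T Γ Δ) (k : Tm (sig target) Δ nat) (a : Tms T Δ (positive R)) d →
      formula P η (k ∷ a) d ≡ formula R (k ∷ η) a d
    premise≡bounded η k a d = cong ∀̇ (cong₂ _⊃_
      (sym (trans (∀∈ᴵ-reindex (lift wkₛ) B (liftEnv T σ (k ∷ η)) [] _)
        (∀∈ᴵ-cong B env refl refl)))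
      (cong ∃̇ (cong (∀∈ T (negative C) _) (cong₂ _∧̇_ refl (sym (formula-cong C
        (trans (sym (⊙-✶ (lift (lift wkₛ)) (liftEnv T nat (liftEnv T σ (k ∷ η))) _))
          (cong (wkEnv T (map type (negative C)))
            (trans (lift-⊙ nat (lift wkₛ) (liftEnv T σ (k ∷ η))) (cong (liftEnv T nat) env))))
        refl refl))))))
      where
      env : lift wkₛ ⊙ liftEnv T σ (_∷_ {x = nat} k η) ≡ liftEnv T σ η
      env = trans (lift-⊙ σ wkₛ (k ∷ η)) (cong (liftEnv T σ) (wkₛ-⊙ nat k η))

    kernel-stable : Stable K
    kernel-stable = ∧-stable I R (rel-stable (bounding T) (v₀ ∷ []))
      (∀-stable (⊃ᴵ B⁺ (∃ᴵ M)) (⊃-stable B⁺ (∃ᴵ M) (reindex-stable (lift wkₛ) B stB)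
        (∃-stable M (∧-stable N C⁺ (≐-stable (v₀ ∸̇ v₂) (core O))
          (reindex-stable (lift (lift wkₛ)) C stC)))))
      where
      N  = ≐ᴵ (v₀ ∸̇ v₂) (core O)
      B⁺ = reindex (lift wkₛ) B
      C⁺ = reindex (lift (lift wkₛ)) C
      M  = matrixᴵ (bounding T) B C

    -- `k` is used twice, as the value of the existential quantifier and as the witness of its
    -- guard, which then reads `k ≤ k`. The types of `D` are already those of finite sets of
    -- negative witnesses of `P`.
    premise⊃conclusion : ∀ {Δ} (η : Env T Γ Δ) (a : Tms T Δ (positive P)) (D : Tms T Δ (negative Q)) →
      Axiom ⊢ ∀∈ᴵ P η a D ⊃ formula Q η a D
    premise⊃conclusion η (k ∷ a) D =
      ⊃I (∃ᴵ-I K kernel-stable η (k ∷ a) D k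
        (⊃E (weaken (∀∈-mono (negative P) D
          (⊃I (∧I (≤̇-refl (k ⟨ wks Ξ ⟩ₜ)) (⊢-≡
            (premise≡bounded (wkEnv T Ξ η) (k ⟨ wks Ξ ⟩ₜ) (wkTms T Ξ a) (vars T (negative P)))
            (hyp (here refl)))))))
          (hyp (here refl))))
      where
      Ξ = map type (negative P)

    -- Applied to `a` and `D`, the realizers are provably equal to `a` and `D`. One replacement
    -- adjusts the bounds in the hypothesis, another the witnesses in the conclusion.
    Realizable-premise⊃conclusion : Realizable (⊃ᴵ P Q)
    Realizable-premise⊃conclusion = ++⁺ f g , λ η ad →
      let a = ++⁻ˡ (positive P) ad
          D = ++⁻ʳ (positive P) ad
      in ⊃I (formula-replace Q (∃-stable K kernel-stable) η D
           (EqualTms-sym (EqualTms-trans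
             (apply-cong (positive P) {positive Q} a (EqualTms-≡ f-✶))
             (apply-projections (positive P) a)))
           (⊃E (weaken (premise⊃conclusion η a D))
             (∀∈-replace (negative P) (generic P η a)
               (EqualTms-trans
                 (apply-cong (negative Q) {negative Q} D (EqualTms-trans
                   (apply-cong (positive P) {gs} a (EqualTms-≡ g-✶))
                   (apply-constant-funs (positive P) (projections (negative Q)) a)))
                 (apply-projections (negative Q) D))
               (hyp (here refl)))))
      where
      fs = map (arrow T (positive P)) (positive Q)
      gs = map (arrow T (negative Q)) (map _⋆ʷ (negative P))

      f : Tms T [] fs
      f = projections (positive P)

      g : Tms T [] (map (arrow T (positive P)) gs)
      -- The sets for the premise may depend on both `a` and `D`; here `a` is discarded and `D`
      -- returned.
      g = constant-funs (positive P) (projections (negative Q))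

      f-✶ : ∀ {Δ} → ++⁻ˡ fs (_✶_ {Δ = Δ} (++⁺ f g) []) ≡ projections (positive P)
      f-✶ = trans (cong (++⁻ˡ fs) (map-++⁺ (_⟨ [] ⟩ₜ) f g))
        (trans (++⁻ˡ-++⁺ (f ✶ []) (g ✶ [])) (projections-✶ (positive P) []))

      g-✶ : ∀ {Δ} → ++⁻ʳ fs (_✶_ {Δ = Δ} (++⁺ f g) [])
                    ≡ constant-funs (positive P) (projections (negative Q))
      g-✶ = trans (cong (++⁻ʳ fs) (map-++⁺ (_⟨ [] ⟩ₜ) f g))
        (trans (++⁻ʳ-++⁺ (f ✶ []) (g ✶ []))
          (trans (constant-funs-✶ (positive P) (projections (negative Q)) [])
            (cong (constant-funs (positive P)) (projections-✶ (negative Q) []))))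

  -- Generalizing `atom (𝓘 nat)` and the interpretation of `B` to variables makes it possible to
  -- match both equations with `refl`.
  Realizable-collectionᴵ : ∀ {Γ σ} (α : AtomInterpretation T (nat ∷ [])) → α ≡ bounding T →
    (B : Interp (σ ∷ Γ)) → positive B ≡ [] → (C : Interp (nat ∷ σ ∷ Γ)) →
    Stable B → Stable C →
    Realizable (⊃ᴵ (premiseᴵ α B C) (conclusionᴵ α B C))
  Realizable-collectionᴵ _ refl (interp .[] n F) refl C stB stC =
    Realizable-premise⊃conclusion F C stB stC

  -- From formulas to interpretations

  module _ (β : BaseInterpretation T) where
    open BaseInterpretation β

    ⌊_⌋ : ∀ {Γ} → Fm (L with𝓘) plain Γ → Interp Γ
    ⌊ A ⌋ = interp (pos T β A) (neg T β A) (⟪_⟫ T β A)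

    ⌊⌋-stable : ∀ {Γ} (A : Fm (L with𝓘) plain Γ) → Stable ⌊ A ⌋
    ⌊⌋-stable ⊥̇          = λ θ η a b → refl
    ⌊⌋-stable (t ≐ u)    = ≐-stable t u
    ⌊⌋-stable (rel R ts) = rel-stable (atom R) ts
    ⌊⌋-stable (A ∧̇ B)    = ∧-stable ⌊ A ⌋ ⌊ B ⌋ (⌊⌋-stable A) (⌊⌋-stable B)
    ⌊⌋-stable (A ⊃ B)    = ⊃-stable ⌊ A ⌋ ⌊ B ⌋ (⌊⌋-stable A) (⌊⌋-stable B)
    ⌊⌋-stable (∀̇ A)      = ∀-stable ⌊ A ⌋ (⌊⌋-stable A)
    ⌊⌋-stable (∃̇ A)      = ∃-stable ⌊ A ⌋ (⌊⌋-stable A)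

    ⌊⌋-⟨⟩ : ∀ {Γ Γ′} (A : Fm (L with𝓘) plain Γ) (θ : Sub (sig L) Γ Γ′) →
      ⌊ A ⟨ θ ⟩ ⌋ ≈ reindex θ ⌊ A ⌋
    ⌊⌋-⟨⟩ ⊥̇          θ = same λ η a b → refl
    ⌊⌋-⟨⟩ (t ≐ u)    θ = same λ η a b → cong₂ _≐_ (⟦⟧-⟨⟩ t θ η) (⟦⟧-⟨⟩ u θ η)
    ⌊⌋-⟨⟩ (rel R ts) θ = same λ η a b →
      cong (λ η → AtomInterpretation.formula (atom R) ⟨ ++⁺ (map⁺ η) (++⁺ (map⁺ a) (map⁺ b)) ⟩)
        (✶-⊙ ts θ η)
    ⌊⌋-⟨⟩ (A ∧̇ B)    θ = ≈-trans (∧-≈ (⌊⌋-⟨⟩ A θ) (⌊⌋-⟨⟩ B θ)) (same λ η a b → refl)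
    ⌊⌋-⟨⟩ (A ⊃ B)    θ = ≈-trans (⊃-≈ (⌊⌋-⟨⟩ A θ) (⌊⌋-⟨⟩ B θ)) (⊃-reindex θ ⌊ A ⌋ ⌊ B ⌋)
    ⌊⌋-⟨⟩ (∀̇ A)      θ = ≈-trans (∀-≈ (⌊⌋-⟨⟩ A (lift θ))) (∀-reindex θ ⌊ A ⌋)
    ⌊⌋-⟨⟩ (∃̇ A)      θ = ≈-trans (∃-≈ (⌊⌋-⟨⟩ A (lift θ))) (∃-reindex θ ⌊ A ⌋)

    Realizable-closure : ∀ Γ (A : Fm (L with𝓘) plain Γ) →
      Realizable ⌊ A ⌋ → Realizable ⌊ closure𝓘 Γ A ⌋
    Realizable-closure []      A r = r
    Realizable-closure (σ ∷ Γ) A r = Realizable-closure Γ (∀̇ (In v₀ ⊃ A))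
      (Realizable-∀ ⌊ In v₀ ⊃ A ⌋ (Realizable-⊃ ⌊ In v₀ ⌋ ⌊ A ⌋ (⌊⌋-stable A) r))

    -- The instance of realizability at the source variables and at variables for the negative
    -- witnesses.
    Realizable⇒UInterpretable : ∀ {Γ} (A : Fm (L with𝓘) plain Γ) →
      Realizable ⌊ A ⌋ → UInterpretable T β A
    Realizable⇒UInterpretable A (t , r) = t , ∀⋆-I (map type (neg T β A)) (r _ _)

    ⌊^𝓘⌋-⟨⟩ : ∀ {q Γ Δ} (A : Fm L q Γ) (θ : Sub (sig L) Γ Δ) →
      ⌊ (A ⟨ θ ⟩) ^𝓘 ⌋ ≈ reindex θ ⌊ A ^𝓘 ⌋
    ⌊^𝓘⌋-⟨⟩ A θ = subst (λ A′ → ⌊ A′ ⌋ ≈ reindex θ ⌊ A ^𝓘 ⌋) (sym (^𝓘-⟨⟩ A θ)) (⌊⌋-⟨⟩ (A ^𝓘) θ)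

    module _ {σ Y} Z (B : Fm L restricted (σ ∷ Y)) (C : Fm L restricted (nat ∷ σ ∷ Z ++ Y)) where

      private
        B₁ = B ⟨ lift (wks Z) ⟩
        𝓘ℕ = atom (𝓘 nat)
        P  = premiseᴵ 𝓘ℕ ⌊ B₁ ^𝓘 ⌋ ⌊ C ^𝓘 ⌋
        Q  = conclusionᴵ 𝓘ℕ ⌊ B₁ ^𝓘 ⌋ ⌊ C ^𝓘 ⌋

      -- Only the copies of `B₁` and `C` under the binder of `k` need the substitution lemma; the
      -- premise, the guard on `k` and the bound `n ≤ k` match by definition.
      ⌊collection⌋ : ⌊ collection Z B C ^𝓘 ⌋ ≈ ⊃ᴵ P Q
      ⌊collection⌋ = ⊃-≈ (≈-refl P)
        (∃-≈ (∧-≈ (≈-refl (relᴵ 𝓘ℕ (v₀ ∷ [])))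
          (∀-≈ (⊃-≈ (⌊^𝓘⌋-⟨⟩ B₁ (lift wkₛ))
            (∃-≈ (∧-≈ (≈-refl (≐ᴵ (v₀ ∸̇ v₂) (core O))) (⌊^𝓘⌋-⟨⟩ C (lift (lift wkₛ)))))))))

      Realizable-collection : 𝓘ℕ ≡ bounding T → pos T β (B ^𝓘) ≡ [] →
        Realizable ⌊ collection Z B C ^𝓘 ⌋
      Realizable-collection isBounding noWitnesses = Realizable-≈ ⌊collection⌋
        (Realizable-collectionᴵ 𝓘ℕ isBounding ⌊ B₁ ^𝓘 ⌋
          -- Adding the parameters `Z` does not change the positive witness types of `B`.
          (trans (positive-≈ (⌊^𝓘⌋-⟨⟩ B (lift (wks Z)))) noWitnesses) ⌊ C ^𝓘 ⌋
          (⌊⌋-stable (B₁ ^𝓘)) (⌊⌋-stable (C ^𝓘)))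

theorem9p13 : (S : ExtensionOfHAω) → let L = ExtensionOfHAω.𝓛 S in
    (T : TargetTheory L)
    (β : BaseInterpretation T) →
    UsesBoundingAtℕ T β →
    {σ : Type L} {Y Z : Cxt L}
    (B : Fm L restricted (σ ∷ Y)) →
    SemiUniform T β B →
    (C : Fm L restricted (nat ∷ σ ∷ Z ++ Y)) →
    𝓘-Interpretable T β (collection Z B C)
theorem9p13 S T β isBounding {Y = Y} {Z} B (_ , noWitnesses) C =
  Realizable⇒UInterpretable T β (closure𝓘 (Z ++ Y) (collection Z B C ^𝓘))
    (Realizable-closure T β (Z ++ Y) (collection Z B C ^𝓘)
      (Realizable-collection T β Z B C isBounding noWitnesses))
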